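{- We have $$C_{1324,4321}(x)=\left(1+\sum_{k\ge 1}\frac{x^k}{1-x^k}+\sum_{k\ge 1}\sum_{i\ge k+1}\frac{x^{k+i}}{(1-x^k)(1-x^i)}\right)^2.$$
   Context: $\mathrm{av}_n^k(B)$ is the number of permutations in $S_n$ with exactly $k$ inversions (pairs $i<j$ with $\pi_i>\pi_j$) that avoid every pattern in $B$; a permutation avoids a pattern $q$ if it has no subsequence order-isomorphic to $q$. If for every $k\ge0$ there are constants $m_k,c_k(B)$ with $\mathrm{av}_n^k(B)=c_k(B)$ for all $n\ge m_k$, then $(c_k(B))_{k\ge0}$ is the limit sequence of $B$ and $C_B(x)=\sum_{k\ge 0}c_k(B)x^k$ is its limit generating function (a formal power series); here $B=\{1324,4321\}$. -}

module Defs where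

open import Data.Bool.Base using (if_then_else_)
open import Data.Fin.Base as Fin using (Fin; toℕ)
open import Data.Fin using (#_)
import Data.Fin.Properties as Fin
open import Data.Integer.Base as ℤ using (ℤ; 0ℤ; 1ℤ; +_)
import Data.Integer.Properties as ℤ
open import Data.List.Base using (List; [_]; allFin; cartesianProduct; cartesianProductWith; filter; length)
open import Data.List.Relation.Unary.All as All using (All)
open import Data.Nat.Base as ℕ using (ℕ; zero; suc; _≤_; _<_; _≥_; _∸_; _≡ᵇ_; z≤n; s≤s)
import Data.Nat.Properties as ℕ
open import Data.Product.Base using (∃; ∃-syntax; _×_; _,_; proj₁; proj₂)
open import Data.Vec.Base as Vec using (Vec; []; _∷_; lookup; head)
open import Data.Vec.Relation.Unary.AllPairs using (AllPairs; allPairs?)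
open import Data.Vec.Relation.Unary.Unique.Propositional using (Unique)
open import Function.Bundles using (_⇔_; mk⇔; Equivalence)
open import Relation.Binary.PropositionalEquality using (_≡_; _≗_; refl; sym; trans; cong; cong₂; module ≡-Reasoning)
open import Relation.Nullary.Decidable using (Dec; map′; _×-dec_; _→-dec_; ¬?)
open import Relation.Nullary.Negation using (¬_)
open import Relation.Unary using (Decidable)
open import Algebra.Properties.Monoid.Sum ℤ.+-0-monoid using (sum; sum-syntax; sum-cong-≗; sum-replicate-zero)

-- Permutations in one-line notation, with values and positions counted from 0.

Word : ℕ → Set
Word n = Vec (Fin n) n

IsPermutation : ∀ {n} → Word n → Set
IsPermutation = Unique

vecs : ∀ n m → List (Vec (Fin n) m)
vecs n zero    = [ [] ]
vecs n (suc m) = cartesianProductWith _∷_ (allFin n) (vecs n m)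

isPermutation? : ∀ {n} → Decidable (IsPermutation {n})
isPermutation? = allPairs? (λ x y → ¬? (x Fin.≟ y))

Inversion : ∀ {n} → Word n → Fin n × Fin n → Set
Inversion π (i , j) = i Fin.< j × lookup π j Fin.< lookup π i

inversion? : ∀ {n} (π : Word n) → Decidable (Inversion π)
inversion? π (i , j) = (i Fin.<? j) ×-dec (lookup π j Fin.<? lookup π i)

inversions : ∀ {n} → Word n → ℕ
inversions {n} π = length (filter (inversion? π) (cartesianProduct (allFin n) (allFin n)))

OrderIsomorphic : ∀ {n k m} → Vec (Fin n) m → Vec (Fin k) m → Set
OrderIsomorphic u v = ∀ a b → (lookup u a Fin.< lookup u b) ⇔ (lookup v a Fin.< lookup v b)

-- `is` lists the positions of the subsequence.
IsOccurrence : ∀ {n m} → Word m → Word n → Vec (Fin n) m → Set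
IsOccurrence q π is = AllPairs Fin._<_ is × OrderIsomorphic (Vec.map (lookup π) is) q

Contains : ∀ {n m} → Word n → Word m → Set
Contains π q = ∃ (IsOccurrence q π)

Pattern : Set
Pattern = ∃ Word

Avoids : ∀ {n} → Word n → Pattern → Set
Avoids π (_ , q) = ¬ Contains π q

_⇔?_ : ∀ {A B : Set} → Dec A → Dec B → Dec (A ⇔ B)
a? ⇔? b? = map′ (λ (f , g) → mk⇔ f g) (λ e → Equivalence.to e , Equivalence.from e)
                ((a? →-dec b?) ×-dec (b? →-dec a?))

orderIsomorphic? : ∀ {n k m} (u : Vec (Fin n) m) (v : Vec (Fin k) m) → Dec (OrderIsomorphic u v)
orderIsomorphic? u v = Fin.all? λ a → Fin.all? λ b →
  (lookup u a Fin.<? lookup u b) ⇔? (lookup v a Fin.<? lookup v b)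

anyVec? : ∀ {n m} {P : Vec (Fin n) m → Set} → Decidable P → Dec (∃ P)
anyVec? {m = zero}  P? = map′ ([] ,_) (λ { ([] , p) → p }) (P? [])
anyVec? {m = suc m} P? =
  map′ (λ (x , xs , p) → x ∷ xs , p) (λ { (x ∷ xs , p) → x , xs , p })
       (Fin.any? λ x → anyVec? λ xs → P? (x ∷ xs))

contains? : ∀ {n m} (π : Word n) (q : Word m) → Dec (Contains π q)
contains? π q = anyVec? λ is → allPairs? Fin._<?_ is ×-dec orderIsomorphic? (Vec.map (lookup π) is) q

avoids? : ∀ {n} (π : Word n) → Decidable (Avoids π)
avoids? π (_ , q) = ¬? (contains? π q)

Counted : List Pattern → ∀ n → ℕ → Word n → Set
Counted B n k π = IsPermutation π × inversions π ≡ k × All (Avoids π) B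

counted? : ∀ B n k → Decidable (Counted B n k)
counted? B n k π = isPermutation? π ×-dec ((inversions π ℕ.≟ k) ×-dec All.all? (avoids? π) B)

av : List Pattern → ℕ → ℕ → ℕ
av B n k = length (filter (counted? B n k) (vecs n n))

IsLimitSequence : List Pattern → (ℕ → ℕ) → Set
IsLimitSequence B c = ∀ k → ∃[ m ] ∀ n → n ≥ m → av B n k ≡ c k

p1324 p4321 : Pattern
p1324 = 4 , # 0 ∷ # 2 ∷ # 1 ∷ # 3 ∷ []
p4321 = 4 , # 3 ∷ # 2 ∷ # 1 ∷ # 0 ∷ []

-- Formal power series over ℤ, as coefficient sequences; equality is _≗_.

PowerSeries : Set
PowerSeries = ℕ → ℤ

generatingFunction : (ℕ → ℕ) → PowerSeries
generatingFunction c k = + c k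

infixl 6 _+_ _-_
infixl 7 _*_ _/_
infix  8 x^_
infix  9 _²

x^_ : ℕ → PowerSeries
(x^ k) n = if k ≡ᵇ n then 1ℤ else 0ℤ

1ₛ : PowerSeries
1ₛ = x^ 0

_+_ _-_ _*_ : PowerSeries → PowerSeries → PowerSeries
(f + g) n = f n ℤ.+ g n
(f - g) n = f n ℤ.- g n
(f * g) n = ∑[ i < suc n ] (f (toℕ i) ℤ.* g (n ∸ toℕ i))

_² : PowerSeries → PowerSeries
f ² = f * f

-- The first n coefficients of f / g, the highest one first, obtained by
-- solving g * h = f for h under the assumption g 0 ≡ 1.
quotientPrefix : PowerSeries → PowerSeries → ∀ n → Vec ℤ n
quotientPrefix f g zero    = []
quotientPrefix f g (suc n) =
  (f n ℤ.- ∑[ i < n ] (g (suc (toℕ i)) ℤ.* lookup (quotientPrefix f g n) i)) ∷ quotientPrefix f g n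

-- Meaningful only if g 0 ≡ 1, see /-correct.
_/_ : PowerSeries → PowerSeries → PowerSeries
(f / g) n = head (quotientPrefix f g (suc n))

lookup-quotientPrefix : ∀ f g n (i : Fin n) →
  lookup (quotientPrefix f g n) i ≡ (f / g) (n ∸ suc (toℕ i))
lookup-quotientPrefix f g (suc n) Fin.zero    = refl
lookup-quotientPrefix f g (suc n) (Fin.suc i) = lookup-quotientPrefix f g n i

/-correct : ∀ f g → g 0 ≡ 1ℤ → g * (f / g) ≗ f
/-correct f g g0≡1 n = begin
  g 0 ℤ.* (f n ℤ.- S) ℤ.+ T  ≡⟨ cong (λ z → z ℤ.* (f n ℤ.- S) ℤ.+ T) g0≡1 ⟩
  1ℤ ℤ.* (f n ℤ.- S) ℤ.+ T   ≡⟨ cong (ℤ._+ T) (ℤ.*-identityˡ (f n ℤ.- S)) ⟩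
  f n ℤ.- S ℤ.+ T            ≡⟨ cong (λ z → f n ℤ.- S ℤ.+ z) T≡S ⟩
  f n ℤ.- S ℤ.+ S            ≡⟨ ℤ.+-assoc (f n) (ℤ.- S) S ⟩
  f n ℤ.+ (ℤ.- S ℤ.+ S)      ≡⟨ cong (λ z → f n ℤ.+ z) (ℤ.+-inverseˡ S) ⟩
  f n ℤ.+ 0ℤ                 ≡⟨ ℤ.+-identityʳ (f n) ⟩
  f n                        ∎
  where
  open ≡-Reasoning
  S T : ℤ
  S = ∑[ i < n ] (g (suc (toℕ i)) ℤ.* lookup (quotientPrefix f g n) i)
  T = ∑[ i < n ] (g (suc (toℕ i)) ℤ.* (f / g) (n ∸ suc (toℕ i)))
  T≡S : T ≡ S
  T≡S = sum-cong-≗ λ i → cong (g (suc (toℕ i)) ℤ.*_) (sym (lookup-quotientPrefix f g n i))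

-- Each coefficient is nonzero in only finitely many terms of the family.
Summable : (ℕ → PowerSeries) → Set
Summable f = ∀ n → ∃[ N ] ∀ k → k ≥ N → f k n ≡ 0ℤ

-- ∑≥ a f is the infinite sum of f k over all k ≥ a.
∑≥ : ℕ → (f : ℕ → PowerSeries) → Summable f → PowerSeries
∑≥ a f s n = ∑[ j < proj₁ (s n) ∸ a ] f (a ℕ.+ toℕ j) n

sum-zero : ∀ {n} (t : Fin n → ℤ) → (∀ i → t i ≡ 0ℤ) → sum t ≡ 0ℤ
sum-zero {n} t t≡0 = trans (sum-cong-≗ t≡0) (sum-replicate-zero n)

∑≥-zero : ∀ a f s n → (∀ k → f k n ≡ 0ℤ) → ∑≥ a f s n ≡ 0ℤ
∑≥-zero a f s n f≡0 = sum-zero {proj₁ (s n) ∸ a} (λ j → f (a ℕ.+ toℕ j) n) λ j → f≡0 (a ℕ.+ toℕ j)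

/-zero : ∀ f g n → (∀ m → m ≤ n → f m ≡ 0ℤ) → (f / g) n ≡ 0ℤ
/-zero f g n f≡0 = prefix-zero (suc n) (λ m m<1+n → f≡0 m (ℕ.≤-pred m<1+n)) Fin.zero
  where
  prefix-zero : ∀ n → (∀ m → m < n → f m ≡ 0ℤ) → ∀ i → lookup (quotientPrefix f g n) i ≡ 0ℤ
  prefix-zero (suc n) f≡0 Fin.zero = cong₂ ℤ._-_ (f≡0 n ℕ.≤-refl) (sum-zero _ λ i →
    trans (cong (g (suc (toℕ i)) ℤ.*_) (prefix-zero n (λ m m<n → f≡0 m (ℕ.m≤n⇒m≤1+n m<n)) i))
          (ℤ.*-zeroʳ (g (suc (toℕ i)))))
  prefix-zero (suc n) f≡0 (Fin.suc i) = prefix-zero n (λ m m<n → f≡0 m (ℕ.m≤n⇒m≤1+n m<n)) i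

x^-zero : ∀ k n → n < k → (x^ k) n ≡ 0ℤ
x^-zero (suc k) zero    _         = refl
x^-zero (suc k) (suc n) (s≤s n<k) = x^-zero k n n<k

x^/-zero : ∀ k g n → n < k → (x^ k / g) n ≡ 0ℤ
x^/-zero k g n n<k = /-zero (x^ k) g n λ m m≤n → x^-zero k m (ℕ.≤-<-trans m≤n n<k)

singleTerm : ℕ → PowerSeries
singleTerm k = x^ k / (1ₛ - x^ k)

doubleTerm : ℕ → ℕ → PowerSeries
doubleTerm k i = x^ (k ℕ.+ i) / ((1ₛ - x^ k) * (1ₛ - x^ i))

singleTerm-summable : Summable singleTerm
singleTerm-summable n = suc n , λ k n<k → x^/-zero k (1ₛ - x^ k) n n<k

doubleTerm-summable : ∀ k → Summable (doubleTerm k)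
doubleTerm-summable k n = suc n , λ i n<i →
  x^/-zero (k ℕ.+ i) ((1ₛ - x^ k) * (1ₛ - x^ i)) n (ℕ.<-≤-trans n<i (ℕ.m≤n+m i k))

innerSum : ℕ → PowerSeries
innerSum k = ∑≥ (suc k) (doubleTerm k) (doubleTerm-summable k)

innerSum-summable : Summable innerSum
innerSum-summable n = suc n , λ k n<k →
  ∑≥-zero (suc k) (doubleTerm k) (doubleTerm-summable k) n λ i →
    x^/-zero (k ℕ.+ i) ((1ₛ - x^ k) * (1ₛ - x^ i)) n (ℕ.<-≤-trans n<k (ℕ.m≤m+n k i))

{-# OPTIONS --safe #-}
-- An inversion (a , b) of a 1324-avoiding permutation cannot have both a smaller entry
-- in front of and a larger entry behind its two entries, so a and b together take part in
-- many inversions. Hence a 1324-avoider of length m + n with k < m , n inversions has no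
-- inversion across position m: it is α ⊕ β, where α avoids 132 and β avoids 213.
-- The Lehmer code of a 132-avoider is a partition of its number of inversions, and its
-- longest decreasing subsequence has one more entry than the partition has different
-- part sizes. So α, and by symmetry the reverse complement of β, corresponds to a partition
-- with at most two part sizes, and such partitions are counted by the series that is squared.
module Submission where

open import Defs
open import Data.List.Base using (List; []; _∷_)
open import Data.Nat.Base using (ℕ)
open import Data.Product.Base using (∃-syntax; _×_)
open import Relation.Binary.PropositionalEquality using (_≗_)

open import Data.Empty using (⊥; ⊥-elim)
open import Data.Fin.Base as Fin using (Fin; zero; suc; toℕ; punchIn; punchOut; opposite; inject≤; _↑ˡ_; _↑ʳ_; splitAt; fromℕ<)
open import Data.Fin.Patterns using (0F; 1F; 2F; 3F)
import Data.Fin.Properties as Fin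
open import Data.Integer.Base as ℤ using (ℤ; +_; 0ℤ; 1ℤ)
import Data.Integer.Properties as ℤ
open import Algebra.Properties.Monoid.Sum ℤ.+-0-monoid using (sum-syntax; sum-cong-≗)
open import Data.Integer.Solver using (module +-*-Solver)
open import Data.List.Base as List using (_++_; length; allFin; cartesianProduct; filter; concat)
import Data.List.Properties as List
open import Data.List.Membership.Propositional using (_∈_)
open import Data.List.Membership.Propositional.Properties
open import Data.List.Relation.Binary.Disjoint.Propositional using (Disjoint)
open import Data.List.Relation.Unary.All as All using ([]; _∷_)
import Data.List.Relation.Unary.All.Properties as All
open import Data.List.Relation.Unary.AllPairs as AllPairs using ([]; _∷_)
import Data.List.Relation.Unary.AllPairs.Properties as AllPairs
open import Data.List.Relation.Unary.Any as Any using (here; there)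
open import Data.List.Relation.Unary.Any.Properties using (lookup-index)
open import Data.List.Relation.Unary.Unique.Propositional using (Unique)
import Data.List.Relation.Unary.Unique.Propositional.Properties as Unique
open import Data.Nat.Base as ℕ using (zero; suc; _≤_; _<_; _∸_; z≤n; s≤s; z<s; s<s)
import Data.Nat.Properties as ℕ
open import Data.Nat.Induction using (<-rec)
open import Data.Nat.ListAction using (sum)
open import Data.Product.Base using (_,_; proj₁; proj₂; map)
open import Data.Sum.Base using (_⊎_; inj₁; inj₂; [_,_]′)
open import Data.Unit.Base using (⊤; tt)
open import Data.Vec.Base as Vec using (Vec; []; _∷_; lookup)
import Data.Vec.Properties as Vec
open import Data.Vec.Relation.Unary.All using ([]; _∷_)
open import Data.Vec.Relation.Unary.AllPairs as VecAllPairs using ([]; _∷_)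
import Data.Vec.Relation.Unary.Unique.Propositional.Properties as VecUnique
open import Function.Base using (_∘_; id; case_of_)
open import Function.Bundles using (Equivalence; mk⇔)
open import Relation.Binary.Definitions using (tri<; tri≈; tri>)
open import Relation.Binary.PropositionalEquality using (_≡_; _≢_; refl; sym; trans; cong; cong₂; subst; subst₂; module ≡-Reasoning)
open import Relation.Nullary.Decidable using (yes; no; _×-dec_; from-yes)
open import Relation.Nullary.Negation using (¬_; contradiction)

-- The cut position is prescribed, not chosen to suit the permutation: an avoider may decompose at
-- several positions, but at a given one its summands can be read off, so nothing is counted twice.
-- The bounds `k < m` and `k < n` serve a second time in the converse direction: a partition of at
-- most `k` always fits as a Lehmer code into more than `k` letters, padded by zeros. Hence the
-- count depends neither on the cut nor on the total length.
--
-- Part sizes enter because prepending `c` to a nonempty word with weakly decreasing code lengthens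
-- its longest decreasing subsequence exactly when `c` exceeds the next code entry; a repeated entry
-- changes nothing.
--
-- On the side of the series, quotients are defined by a recursion on coefficients and infinite sums
-- by truncation. So quotients are recognised by multiplying with the denominator, which turns the
-- removal of one part into a linear equation, and the lists of partitions are indexed over the same
-- finite ranges as the truncated sums.

private
  variable
    A B : Set
    k m n : ℕ

-- Counting with lists free of repetitions

lookup-injective : ∀ {xs : List A} → Unique xs → ∀ i j → List.lookup xs i ≡ List.lookup xs j → i ≡ j
lookup-injective (_  ∷ _)   zero    zero    _  = refl
lookup-injective (x∉ ∷ _)   zero    (suc j) eq = contradiction eq (All.lookup x∉ (∈-lookup j))
lookup-injective (x∉ ∷ _)   (suc i) zero    eq = contradiction (sym eq) (All.lookup x∉ (∈-lookup i))
lookup-injective (_  ∷ xs!) (suc i) (suc j) eq = cong suc (lookup-injective xs! i j eq)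

-- Sending each position of `xs` to a position of its entry in `ys` is injective because `xs` has no
-- repetitions. Equal cardinalities thus reduce to two inclusions.
length-mono-⊆ : ∀ {xs ys : List A} → Unique xs → (∀ {z} → z ∈ xs → z ∈ ys) → length xs ≤ length ys
length-mono-⊆ {xs = xs} {ys} xs! xs⊆ys = Fin.injective⇒≤ {f = λ i → Any.index (xs⊆ys (∈-lookup i))} λ {i} {j} eq →
  lookup-injective xs! i j (begin
    List.lookup xs i                                      ≡⟨ lookup-index (xs⊆ys (∈-lookup i)) ⟩
    List.lookup ys (Any.index (xs⊆ys (∈-lookup i)))  ≡⟨ cong (List.lookup ys) eq ⟩
    List.lookup ys (Any.index (xs⊆ys (∈-lookup j)))  ≡⟨ lookup-index (xs⊆ys (∈-lookup j)) ⟨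
    List.lookup xs j                                      ∎)
  where open ≡-Reasoning

length-cong-⊆⊇ : ∀ {xs ys : List A} → Unique xs → Unique ys →
                 (∀ {z} → z ∈ xs → z ∈ ys) → (∀ {z} → z ∈ ys → z ∈ xs) → length xs ≡ length ys
length-cong-⊆⊇ xs! ys! xs⊆ys ys⊆xs = ℕ.≤-antisym (length-mono-⊆ xs! xs⊆ys) (length-mono-⊆ ys! ys⊆xs)

concat-tabulate! : (f : Fin n → List A) → (∀ i → Unique (f i)) →
                   (∀ {i j z} → z ∈ f i → z ∈ f j → i ≡ j) → Unique (concat (List.tabulate f))
concat-tabulate! f f! f-disjoint =
  Unique.concat⁺ (All.tabulate⁺ f!) (AllPairs.tabulate⁺ λ i≢j (z∈fi , z∈fj) → i≢j (f-disjoint z∈fi z∈fj))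

∈-concat-tabulate⁺ : (f : Fin n → List A) → ∀ i {z} → z ∈ f i → z ∈ concat (List.tabulate f)
∈-concat-tabulate⁺ f i z∈ = ∈-concat⁺′ z∈ (∈-tabulate⁺ i)

∈-concat-tabulate⁻ : (f : Fin n → List A) → ∀ {z} → z ∈ concat (List.tabulate f) → ∃[ i ] z ∈ f i
∈-concat-tabulate⁻ f z∈ 
  with xs , z∈xs , xs∈ ← ∈-concat⁻′ (List.tabulate f) z∈
  with i , refl ← ∈-tabulate⁻ xs∈ = i , z∈xs

-- Injectivity is asked for on members only, since `encode` is injective only on pairs of partitions
-- that are small enough to fit.
map-on-! : ∀ {f : A → B} {xs} → Unique xs → (∀ {x y} → x ∈ xs → y ∈ xs → f x ≡ f y → x ≡ y) → Unique (List.map f xs)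
map-on-! []         _   = []
map-on-! (x∉ ∷ xs!) inj =
  All.map⁺ (All.tabulate λ y∈ eq → All.lookup x∉ y∈ (inj (here refl) (there y∈) eq)) ∷
  map-on-! xs! (λ x∈ y∈ → inj (there x∈) (there y∈))

-- A missed value `y` could be punched out of the codomain, leaving an injection from `Fin (suc n)`
-- to `Fin n`.
injective⇒surjective : (f : Fin n → Fin n) → (∀ {i j} → f i ≡ f j → i ≡ j) → ∀ y → ∃[ x ] f x ≡ y
injective⇒surjective {suc n} f f-inj y with Fin.any? (λ x → f x Fin.≟ y)
... | yes x,fx≡y = x,fx≡y
... | no  ∄      = contradiction
  (Fin.injective⇒≤ {f = λ x → punchOut (y≢ x)} λ {i} {j} eq → f-inj (Fin.punchOut-injective (y≢ i) (y≢ j) eq))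
  ℕ.1+n≰n
  where
  y≢ : ∀ x → y ≢ f x
  y≢ x y≡ = ∄ (x , sym y≡)

vec-ext : ∀ {u v : Vec A n} → (∀ i → lookup u i ≡ lookup v i) → u ≡ v
vec-ext {u = u} {v} eq = trans (sym (Vec.tabulate∘lookup u)) (trans (Vec.tabulate-cong eq) (Vec.tabulate∘lookup v))

vec-map-injective : ∀ {f : A → B} → (∀ {x y} → f x ≡ f y → x ≡ y) →
                    ∀ {u v : Vec A n} → Vec.map f u ≡ Vec.map f v → u ≡ v
vec-map-injective f-inj {[]}    {[]}    _  = refl
vec-map-injective f-inj {_ ∷ _} {_ ∷ _} eq =
  cong₂ _∷_ (f-inj (Vec.∷-injectiveˡ eq)) (vec-map-injective f-inj (Vec.∷-injectiveʳ eq))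

vecs! : ∀ n m → Unique (vecs n m)
vecs! n zero    = [] ∷ []
vecs! n (suc m) = Unique.cartesianProductWith⁺ _∷_ Vec.∷-injective (Unique.allFin⁺ n) (vecs! n m)

∈-vecs : (v : Vec (Fin n) m) → v ∈ vecs n m
∈-vecs []      = here refl
∈-vecs (x ∷ v) = ∈-cartesianProductWith⁺ _∷_ (∈-allFin x) (∈-vecs v)

-- Permutations and their inversions

val : Word n → Fin n → ℕ
val π i = toℕ (lookup π i)

val-injective : ∀ {π : Word n} → IsPermutation π → ∀ {i j} → val π i ≡ val π j → i ≡ j
val-injective π! {i} {j} eq = VecUnique.lookup-injective π! i j (Fin.toℕ-injective eq)

isPermutation : ∀ {π : Word n} → (∀ {i j} → lookup π i ≡ lookup π j → i ≡ j) → IsPermutation π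
isPermutation {π = π} inj = subst IsPermutation (Vec.tabulate∘lookup π) (VecUnique.tabulate⁺ inj)

inversionList : (π : Word n) → List (Fin n × Fin n)
inversionList {n} π = filter (inversion? π) (cartesianProduct (allFin n) (allFin n))

∈-inversionList⁺ : ∀ (π : Word n) {p} → Inversion π p → p ∈ inversionList π
∈-inversionList⁺ π {i , j} inv = ∈-filter⁺ (inversion? π) (∈-cartesianProduct⁺ (∈-allFin i) (∈-allFin j)) inv

∈-inversionList⁻ : ∀ (π : Word n) {p} → p ∈ inversionList π → Inversion π p
∈-inversionList⁻ {n} π p∈ = proj₂ (∈-filter⁻ (inversion? π) {xs = cartesianProduct (allFin n) (allFin n)} p∈)

inversionList! : (π : Word n) → Unique (inversionList π)
inversionList! {n} π = Unique.filter⁺ (inversion? π) (Unique.cartesianProduct⁺ (Unique.allFin⁺ n) (Unique.allFin⁺ n))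

inversions-≡ : ∀ (π : Word n) {ps} → Unique ps → (∀ {p} → p ∈ ps → Inversion π p) →
               (∀ {p} → Inversion π p → p ∈ ps) → inversions π ≡ length ps
inversions-≡ π ps! sound complete =
  length-cong-⊆⊇ (inversionList! π) ps! (complete ∘ ∈-inversionList⁻ π) (∈-inversionList⁺ π ∘ sound)

inversions-≥ : ∀ (π : Word n) (g : Fin k → Fin n × Fin n) → (∀ {i j} → g i ≡ g j → i ≡ j) →
               (∀ i → Inversion π (g i)) → k ≤ inversions π
inversions-≥ {k = k} π g g-inj sound = subst (_≤ inversions π) (List.length-tabulate g)
  (length-mono-⊆ (Unique.tabulate⁺ g-inj) λ p∈ → case ∈-tabulate⁻ p∈ of λ { (i , refl) → ∈-inversionList⁺ π (sound i) })

-- Explicit positions and inequalities are easier to carry through `insert`, `_⊕_` and `rc` than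
-- order isomorphisms. Only 1324 and 4321 are compared with `Avoids`.
Has132 Has213 Has1324 Has4321 : Word n → Set
Has132 π = ∃[ a ] ∃[ b ] ∃[ c ] a Fin.< b × b Fin.< c × val π a < val π c × val π c < val π b
Has213 π = ∃[ a ] ∃[ b ] ∃[ c ] a Fin.< b × b Fin.< c × val π b < val π a × val π a < val π c
Has1324 π = ∃[ a ] ∃[ b ] ∃[ c ] ∃[ d ] a Fin.< b × b Fin.< c × c Fin.< d ×
              val π a < val π c × val π c < val π b × val π b < val π d
Has4321 π = ∃[ a ] ∃[ b ] ∃[ c ] ∃[ d ] a Fin.< b × b Fin.< c × c Fin.< d ×
              val π b < val π a × val π c < val π b × val π d < val π c

-- Inserting a first letter: the Lehmer code read from right to left

-- `punchIn c` frees the value `c`. All `c` smaller values then stand behind the new first letter,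
-- so that letter is its own Lehmer code entry.
insert : Fin (suc n) → Word n → Word (suc n)
insert c ρ = c ∷ Vec.map (punchIn c) ρ

punchIn-mono-< : ∀ (c : Fin (suc n)) {u v} → u Fin.< v → punchIn c u Fin.< punchIn c v
punchIn-mono-< c {u} {v} u<v = ℕ.≰⇒> (ℕ.<⇒≱ u<v ∘ Fin.punchIn-cancel-≤ c v u)

punchIn-cancel-< : ∀ (c : Fin (suc n)) {u v} → punchIn c u Fin.< punchIn c v → u Fin.< v
punchIn-cancel-< c {u} {v} lt = ℕ.≰⇒> (ℕ.<⇒≱ lt ∘ Fin.punchIn-mono-≤ c v u)

punchIn-below⁺ : ∀ (c : Fin (suc n)) {v} → toℕ v < toℕ c → toℕ (punchIn c v) < toℕ c
punchIn-below⁺ (suc c) {zero}  _         = z<s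
punchIn-below⁺ (suc c) {suc v} (s≤s v<c) = s≤s (punchIn-below⁺ c v<c)

punchIn-below⁻ : ∀ (c : Fin (suc n)) {v} → toℕ (punchIn c v) < toℕ c → toℕ v < toℕ c
punchIn-below⁻ (suc c) {zero}  _       = z<s
punchIn-below⁻ (suc c) {suc v} (s≤s p) = s≤s (punchIn-below⁻ c p)

punchIn-above⁻ : ∀ (c : Fin (suc n)) {v} → toℕ c < toℕ (punchIn c v) → toℕ c ≤ toℕ v
punchIn-above⁻ c lt = ℕ.≮⇒≥ λ v<c → ℕ.<-asym lt (punchIn-below⁺ c v<c)

punchIn-above⁺ : ∀ (c : Fin (suc n)) {v} → toℕ c ≤ toℕ v → toℕ c < toℕ (punchIn c v)
punchIn-above⁺ c {v} c≤v = ℕ.≤∧≢⇒< (ℕ.≮⇒≥ λ p → ℕ.<⇒≱ (punchIn-below⁻ c p) c≤v)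
                                   (Fin.punchInᵢ≢i c v ∘ sym ∘ Fin.toℕ-injective)

lookup-insert : ∀ c (ρ : Word n) i → lookup (insert c ρ) (suc i) ≡ punchIn c (lookup ρ i)
lookup-insert c ρ i = Vec.lookup-map i (punchIn c) ρ

insert-isPermutation : ∀ c {ρ : Word n} → IsPermutation ρ → IsPermutation (insert c ρ)
insert-isPermutation c {ρ} ρ! = isPermutation λ {i} {j} → inj i j
  where
  inj : ∀ i j → lookup (insert c ρ) i ≡ lookup (insert c ρ) j → i ≡ j
  inj zero    zero    _  = refl
  inj zero    (suc j) eq = contradiction (trans (sym (lookup-insert c ρ j)) (sym eq)) (Fin.punchInᵢ≢i c _)
  inj (suc i) zero    eq = contradiction (trans (sym (lookup-insert c ρ i)) eq) (Fin.punchInᵢ≢i c _)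
  inj (suc i) (suc j) eq = cong suc (VecUnique.lookup-injective ρ! i j (Fin.punchIn-injective c _ _
    (trans (sym (lookup-insert c ρ i)) (trans eq (lookup-insert c ρ j)))))

insert-surjective : (π : Word (suc n)) → IsPermutation π → ∃[ c ] ∃[ ρ ] π ≡ insert c ρ × IsPermutation ρ
insert-surjective {n} (c ∷ v) π! = c , ρ , vec-ext π≗ , isPermutation λ {i} {j} eq →
  Fin.suc-injective (VecUnique.lookup-injective π! (suc i) (suc j) (Fin.punchOut-injective (c≢ i) (c≢ j)
    (trans (sym (Vec.lookup∘tabulate _ i)) (trans eq (Vec.lookup∘tabulate _ j)))))
  where
  c≢ : ∀ i → c ≢ lookup v i
  c≢ i eq with () ← VecUnique.lookup-injective π! zero (suc i) eq
  ρ : Word n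
  ρ = Vec.tabulate λ i → punchOut (c≢ i)
  π≗ : ∀ i → lookup (c ∷ v) i ≡ lookup (insert c ρ) i
  π≗ zero    = refl
  π≗ (suc i) = sym (trans (lookup-insert c ρ i)
    (trans (cong (punchIn c) (Vec.lookup∘tabulate _ i)) (Fin.punchIn-punchOut (c≢ i))))

module _ (c : Fin (suc n)) (ρ : Word n) where

  private
    π = insert c ρ
    val-suc : ∀ i → toℕ (punchIn c (lookup ρ i)) ≡ val π (suc i)
    val-suc i = cong toℕ (sym (lookup-insert c ρ i))

  insert-mono-< : ∀ {i j} → val ρ i < val ρ j → val π (suc i) < val π (suc j)
  insert-mono-< {i} {j} lt = subst₂ _<_ (val-suc i) (val-suc j) (punchIn-mono-< c lt)

  insert-cancel-< : ∀ {i j} → val π (suc i) < val π (suc j) → val ρ i < val ρ j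
  insert-cancel-< {i} {j} lt = punchIn-cancel-< c (subst₂ _<_ (sym (val-suc i)) (sym (val-suc j)) lt)

  insert-below⁺ : ∀ {i} → val ρ i < toℕ c → val π (suc i) < toℕ c
  insert-below⁺ {i} lt = subst (_< toℕ c) (val-suc i) (punchIn-below⁺ c lt)

  insert-below⁻ : ∀ {i} → val π (suc i) < toℕ c → val ρ i < toℕ c
  insert-below⁻ {i} lt = punchIn-below⁻ c (subst (_< toℕ c) (sym (val-suc i)) lt)

  insert-above⁺ : ∀ {i} → toℕ c ≤ val ρ i → toℕ c < val π (suc i)
  insert-above⁺ {i} lt = subst (toℕ c <_) (val-suc i) (punchIn-above⁺ c lt)

  insert-above⁻ : ∀ {i} → toℕ c < val π (suc i) → toℕ c ≤ val ρ i
  insert-above⁻ {i} lt = punchIn-above⁻ c (subst (toℕ c <_) (sym (val-suc i)) lt)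

  -- The new inversions are indexed by the `c` values below the first letter; each of them occurs
  -- somewhere in `ρ` because an injective word is surjective.
  inversions-insert : IsPermutation ρ → inversions π ≡ toℕ c ℕ.+ inversions ρ
  inversions-insert ρ! = begin
    inversions π                                         ≡⟨ inversions-≡ π unique sound (λ {p} → complete p) ⟩
    length (with-first ++ within)                        ≡⟨ List.length-++ with-first ⟩
    length with-first ℕ.+ length within                  ≡⟨ cong₂ ℕ._+_ (List.length-tabulate first-pair)
                                                              (List.length-map shift (inversionList ρ)) ⟩
    toℕ c ℕ.+ inversions ρ                               ∎
    where
    open ≡-Reasoning
    value : Fin (toℕ c) → Fin n
    value v = inject≤ v (ℕ.≤-pred (Fin.toℕ<n c))
    position : Fin n → Fin n
    position v = proj₁ (injective⇒surjective (lookup ρ) (VecUnique.lookup-injective ρ! _ _) v)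
    lookup-position : ∀ v → lookup ρ (position v) ≡ v
    lookup-position v = proj₂ (injective⇒surjective (lookup ρ) (VecUnique.lookup-injective ρ! _ _) v)
    shift : Fin n × Fin n → Fin (suc n) × Fin (suc n)
    shift (i , j) = suc i , suc j
    first-pair : Fin (toℕ c) → Fin (suc n) × Fin (suc n)
    first-pair v = zero , suc (position (value v))
    with-first within : List (Fin (suc n) × Fin (suc n))
    with-first = List.tabulate first-pair
    within = List.map shift (inversionList ρ)
    first-pair-injective : ∀ {u v} → first-pair u ≡ first-pair v → u ≡ v
    first-pair-injective {u} {v} eq = Fin.inject≤-injective _ _ u v
      (trans (sym (lookup-position _))
        (trans (cong (lookup ρ) (Fin.suc-injective (cong proj₂ eq))) (lookup-position _)))
    unique : Unique (with-first ++ within)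
    unique = Unique.++⁺ (Unique.tabulate⁺ first-pair-injective)
      (Unique.map⁺ (λ { refl → refl }) (inversionList! ρ))
      λ (p∈ , p∈′) → case ∈-tabulate⁻ p∈ , ∈-map⁻ shift p∈′ of λ { ((_ , refl) , (_ , _ , ())) }
    sound : ∀ {p} → p ∈ with-first ++ within → Inversion π p
    sound p∈ with ∈-++⁻ with-first p∈
    ... | inj₁ p∈ with v , refl ← ∈-tabulate⁻ p∈ = z<s , insert-below⁺ (subst (_< toℕ c)
          (sym (trans (cong toℕ (lookup-position (value v))) (Fin.toℕ-inject≤ v _))) (Fin.toℕ<n v))
    ... | inj₂ p∈ with (i , j) , q∈ , refl ← ∈-map⁻ shift p∈ with i<j , lt ← ∈-inversionList⁻ ρ q∈ =
          s<s i<j , insert-mono-< lt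
    complete : ∀ p → Inversion π p → p ∈ with-first ++ within
    complete (zero  , suc j) (_ , lt) = ∈-++⁺ˡ (subst (_∈ with-first) (cong (λ i → zero , suc i) eq) (∈-tabulate⁺ v))
      where
      v = fromℕ< (insert-below⁻ lt)
      eq : position (value v) ≡ j
      eq = val-injective ρ! (trans (cong toℕ (lookup-position (value v)))
             (trans (Fin.toℕ-inject≤ v _) (Fin.toℕ-fromℕ< _)))
    complete (suc i , suc j) (s<s i<j , lt) =
      ∈-++⁺ʳ with-first (∈-map⁺ shift (∈-inversionList⁺ ρ (i<j , insert-cancel-< lt)))

-- The first letter, or 0 for the empty word.
first : Vec (Fin n) m → ℕ
first []      = 0
first (x ∷ _) = toℕ x

Has132-insert : ∀ c {ρ : Word n} → Has132 ρ → Has132 (insert c ρ)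
Has132-insert c {ρ} (x , y , z , x<y , y<z , lt , lt′) =
  suc x , suc y , suc z , s<s x<y , s<s y<z , insert-mono-< c ρ lt , insert-mono-< c ρ lt′

-- In a 132 that uses the new letter, the first letter of `ρ` can take its place, being at most `c`.
-- That letter cannot already be the middle entry, for then the last entry would be below `c`.
insert-avoids132 : ∀ c {ρ : Word n} → IsPermutation ρ → first ρ ≤ toℕ c → ¬ Has132 ρ → ¬ Has132 (insert c ρ)
insert-avoids132 c {ρ} ρ! ρ₀≤c av (suc x , suc y , suc z , s<s x<y , s<s y<z , lt , lt′) =
  av (x , y , z , x<y , y<z , insert-cancel-< c ρ lt , insert-cancel-< c ρ lt′)
insert-avoids132 c {ρ@(_ ∷ _)} ρ! ρ₀≤c av (zero , suc zero , suc z , _ , _ , lt , lt′) =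
  ℕ.<⇒≱ (insert-cancel-< c ρ {z} {zero} lt′) (ℕ.≤-trans ρ₀≤c (insert-above⁻ c ρ {z} lt))
insert-avoids132 c {ρ@(_ ∷ _)} ρ! ρ₀≤c av (zero , suc y@(suc _) , suc z@(suc _) , _ , s<s y<z , lt , lt′) =
  av (zero , y , z , z<s , y<z ,
      ℕ.≤∧≢⇒< (ℕ.≤-trans ρ₀≤c (insert-above⁻ c ρ {z} lt)) (λ eq → Fin.0≢1+n (val-injective ρ! {zero} {z} eq)) ,
      insert-cancel-< c ρ {z} {y} lt′)

-- If `c` were below the first letter of `ρ`, the entry of `ρ` with value `c`, which `insert` raises
-- just above the new letter, would come later and complete a 132 with the first two letters. With
-- the preceding lemma, avoiding 132 means that the Lehmer code is weakly decreasing.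
avoids132⇒first≤ : ∀ c {ρ : Word n} → IsPermutation ρ → ¬ Has132 (insert c ρ) → first ρ ≤ toℕ c
avoids132⇒first≤ c {[]}        ρ! av = z≤n
avoids132⇒first≤ c {ρ@(x ∷ _)} ρ! av = ℕ.≮⇒≥ λ c<x →
  let c<n  = ℕ.<-trans c<x (Fin.toℕ<n x)
      p , ρp≡ = injective⇒surjective (lookup ρ) (VecUnique.lookup-injective ρ! _ _) (fromℕ< c<n)
      ρp≡c = trans (cong toℕ ρp≡) (Fin.toℕ-fromℕ< c<n)
      0<p  = ℕ.n≢0⇒n>0 λ p≡0 → ℕ.<⇒≢ c<x (trans (sym ρp≡c) (cong (val ρ) (Fin.toℕ-injective {j = zero} p≡0)))
  in av (zero , suc zero , suc p , z<s , s<s 0<p ,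
         insert-above⁺ c ρ {p} (ℕ.≤-reflexive (sym ρp≡c)) , insert-mono-< c ρ {p} {zero} (subst (_< toℕ x) (sym ρp≡c) c<x))

-- A decreasing subsequence of length j with positions ≥ lo and values < hi.
Descending : ℕ → ℕ → ℕ → Word n → Set
Descending zero    lo hi π = ⊤
Descending (suc j) lo hi π = ∃[ p ] lo ≤ toℕ p × val π p < hi × Descending j (suc (toℕ p)) (val π p) π

Descending-mono : ∀ j {lo hi lo′ hi′} {π : Word n} →
                  (∀ p → lo ≤ toℕ p → val π p < hi → lo′ ≤ toℕ p × val π p < hi′) →
                  Descending j lo hi π → Descending j lo′ hi′ π
Descending-mono zero    f _ = tt
Descending-mono (suc j) f (p , lo≤p , lt , d) = let lo′≤p , lt′ = f p lo≤p lt in p , lo′≤p , lt′ , d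

module _ (c : Fin (suc n)) {ρ : Word n} where

  private π = insert c ρ

  Descending-insert⁻ : ∀ j {lo hi hi′} → (∀ i → val π (suc i) < hi → val ρ i < hi′) →
                       Descending j (suc lo) hi π → Descending j lo hi′ ρ
  Descending-insert⁻ zero    f _ = tt
  Descending-insert⁻ (suc j) f (suc p , s≤s lo≤p , lt , d) =
    p , lo≤p , f p lt , Descending-insert⁻ j (λ _ → insert-cancel-< c ρ) d

  Descending-insert⁺ : ∀ j {lo hi hi′} → (∀ i → val ρ i < hi → val π (suc i) < hi′) →
                       Descending j lo hi ρ → Descending j (suc lo) hi′ π
  Descending-insert⁺ zero    f _ = tt
  Descending-insert⁺ (suc j) f (p , lo≤p , lt , d) =
    suc p , s≤s lo≤p , f p lt , Descending-insert⁺ j (λ _ → insert-mono-< c ρ) d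

  Descending-insert-≡⁺ : ∀ j → Descending j 0 n ρ → Descending j 0 (suc n) π
  Descending-insert-≡⁺ j d = Descending-mono j (λ p _ lt → z≤n , lt)
    (Descending-insert⁺ j {hi′ = suc n} (λ i _ → Fin.toℕ<n (lookup π (suc i))) d)

  -- A decreasing subsequence through the new letter can pass through the first letter of `ρ`
  -- instead: its later entries have values below `c` and so differ from that letter. The length is
  -- at least two because `ρ` may be empty, with `first ρ` equal to 0 by default.
  Descending-insert-≡⁻ : ∀ j → first ρ ≡ toℕ c → Descending (2 ℕ.+ j) 0 (suc n) π → Descending (2 ℕ.+ j) 0 n ρ
  Descending-insert-≡⁻ j ρ₀≡c (suc p , _ , lt , d) =
    p , z≤n , Fin.toℕ<n (lookup ρ p) , Descending-insert⁻ (suc j) (λ _ → insert-cancel-< c ρ) d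
  Descending-insert-≡⁻ j ρ₀≡c (zero , _ , _ , d) = go ρ ρ₀≡c (Descending-insert⁻ (suc j) (λ _ → insert-below⁻ c ρ) d)
    where
    go : ∀ {n} (ρ : Word n) {c} → first ρ ≡ c → Descending (suc j) 0 c ρ → Descending (2 ℕ.+ j) 0 n ρ
    go []          _    (() , _)
    go ρ@(x ∷ _) refl d = zero , z≤n , Fin.toℕ<n x , Descending-mono (suc j) (λ where
      zero    _ lt → contradiction lt (ℕ.<-irrefl refl)
      (suc p) _ lt → z<s , lt) d

  Descending-insert-<⁻ : ∀ j → Descending (suc j) 0 (suc n) π → Descending j 0 n ρ
  Descending-insert-<⁻ j (zero  , _ , _ , d) = Descending-insert⁻ j (λ i _ → Fin.toℕ<n (lookup ρ i)) d
  Descending-insert-<⁻ j (suc p , _ , _ , d) =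
    Descending-insert⁻ j (λ i _ → Fin.toℕ<n (lookup ρ i)) (Descending-mono j (λ p lo lt → ℕ.≤-trans z<s lo , lt) d)

  -- In a 132-avoiding word, the first entry of a decreasing subsequence may be
  -- replaced by the first letter of the word.
  Descending-insert-<⁺ : ∀ j → IsPermutation ρ → ¬ Has132 ρ → first ρ < toℕ c →
                         Descending (suc j) 0 n ρ → Descending (2 ℕ.+ j) 0 (suc n) π
  Descending-insert-<⁺ j ρ! av ρ₀<c (p , _ , _ , d) =
    zero , z≤n , Fin.toℕ<n c , Descending-insert⁺ (suc j) (λ _ → insert-below⁺ c ρ) (go ρ ρ! av ρ₀<c p d)
    where
    go : ∀ {n} (ρ : Word n) {c} → IsPermutation ρ → ¬ Has132 ρ → first ρ < c →
         ∀ p → Descending j (suc (toℕ p)) (val ρ p) ρ → Descending (suc j) 0 c ρ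
    go ρ@(_ ∷ _) ρ! av ρ₀<c zero      d = zero , z≤n , ρ₀<c , d
    -- A later entry with a value below that at `p` but above the first letter would complete a 132
    -- with these two.
    go ρ@(_ ∷ _) ρ! av ρ₀<c p@(suc _) d = zero , z≤n , ρ₀<c , Descending-mono j (λ q p<q lt →
      ℕ.≤-trans z<s p<q , ℕ.≰⇒> λ ρ₀≤ → av (zero , p , q , z<s , p<q , ℕ.≤∧≢⇒< ρ₀≤ (λ eq →
        ℕ.<⇒≱ p<q (subst (λ i → toℕ i ≤ toℕ p) (val-injective ρ! {zero} {q} eq) z≤n)) , lt)) d

-- Direct sums

infixr 5 _⊕_

_⊕_ : Word m → Word n → Word (m ℕ.+ n)
_⊕_ {m} {n} α β = Vec.map (_↑ˡ n) α Vec.++ Vec.map (m ↑ʳ_) β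

⊕-injective : ∀ (α α′ : Word m) {β β′ : Word n} → α ⊕ β ≡ α′ ⊕ β′ → α ≡ α′ × β ≡ β′
⊕-injective {m} {n} α α′ eq with eqˡ , eqʳ ← Vec.++-injective (Vec.map (_↑ˡ n) α) (Vec.map (_↑ˡ n) α′) eq =
  vec-map-injective (Fin.↑ˡ-injective n _ _) eqˡ , vec-map-injective (Fin.↑ʳ-injective m _ _) eqʳ

data Split (m n : ℕ) : Fin (m ℕ.+ n) → Set where
  left  : ∀ i → Split m n (i ↑ˡ n)
  right : ∀ j → Split m n (m ↑ʳ j)

split : ∀ m {n} i → Split m n i
split m i with splitAt m i in eq
... | inj₁ j = subst (Split m _) (Fin.splitAt⁻¹-↑ˡ eq) (left j)
... | inj₂ j = subst (Split m _) (Fin.splitAt⁻¹-↑ʳ eq) (right j)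

↑ˡ-mono-< : ∀ n {i j : Fin m} → i Fin.< j → i ↑ˡ n Fin.< j ↑ˡ n
↑ˡ-mono-< n {i} {j} = subst₂ _<_ (sym (Fin.toℕ-↑ˡ i n)) (sym (Fin.toℕ-↑ˡ j n))

↑ˡ-cancel-< : ∀ n {i j : Fin m} → i ↑ˡ n Fin.< j ↑ˡ n → i Fin.< j
↑ˡ-cancel-< n {i} {j} = subst₂ _<_ (Fin.toℕ-↑ˡ i n) (Fin.toℕ-↑ˡ j n)

↑ʳ-mono-< : ∀ m {i j : Fin n} → i Fin.< j → m ↑ʳ i Fin.< m ↑ʳ j
↑ʳ-mono-< m {i} {j} i<j = subst₂ _<_ (sym (Fin.toℕ-↑ʳ m i)) (sym (Fin.toℕ-↑ʳ m j)) (ℕ.+-monoʳ-< m i<j)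

↑ʳ-cancel-< : ∀ m {i j : Fin n} → m ↑ʳ i Fin.< m ↑ʳ j → i Fin.< j
↑ʳ-cancel-< m {i} {j} lt = ℕ.+-cancelˡ-< m _ _ (subst₂ _<_ (Fin.toℕ-↑ʳ m i) (Fin.toℕ-↑ʳ m j) lt)

↑ˡ<↑ʳ : ∀ (i : Fin m) (j : Fin n) → i ↑ˡ n Fin.< m ↑ʳ j
↑ˡ<↑ʳ {m} {n} i j = subst₂ _<_ (sym (Fin.toℕ-↑ˡ i n)) (sym (Fin.toℕ-↑ʳ m j)) (ℕ.<-≤-trans (Fin.toℕ<n i) (ℕ.m≤m+n m _))

↑ˡ≢↑ʳ : ∀ (i : Fin m) (j : Fin n) → i ↑ˡ n ≢ m ↑ʳ j
↑ˡ≢↑ʳ i j eq = ℕ.<⇒≢ (↑ˡ<↑ʳ i j) (cong toℕ eq)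

module _ (α : Word m) (β : Word n) where

  lookup-⊕ˡ : ∀ i → lookup (α ⊕ β) (i ↑ˡ n) ≡ lookup α i ↑ˡ n
  lookup-⊕ˡ i = trans (Vec.lookup-++ˡ (Vec.map (_↑ˡ n) α) _ i) (Vec.lookup-map i (_↑ˡ n) α)

  lookup-⊕ʳ : ∀ j → lookup (α ⊕ β) (m ↑ʳ j) ≡ m ↑ʳ lookup β j
  lookup-⊕ʳ j = trans (Vec.lookup-++ʳ (Vec.map (_↑ˡ n) α) _ j) (Vec.lookup-map j (m ↑ʳ_) β)

  ⊕-mono-<ˡ : ∀ {i j} → val α i < val α j → val (α ⊕ β) (i ↑ˡ n) < val (α ⊕ β) (j ↑ˡ n)
  ⊕-mono-<ˡ {i} {j} lt = subst₂ Fin._<_ (sym (lookup-⊕ˡ i)) (sym (lookup-⊕ˡ j)) (↑ˡ-mono-< n lt)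

  ⊕-cancel-<ˡ : ∀ {i j} → val (α ⊕ β) (i ↑ˡ n) < val (α ⊕ β) (j ↑ˡ n) → val α i < val α j
  ⊕-cancel-<ˡ {i} {j} lt = ↑ˡ-cancel-< n (subst₂ Fin._<_ (lookup-⊕ˡ i) (lookup-⊕ˡ j) lt)

  ⊕-mono-<ʳ : ∀ {i j} → val β i < val β j → val (α ⊕ β) (m ↑ʳ i) < val (α ⊕ β) (m ↑ʳ j)
  ⊕-mono-<ʳ {i} {j} lt = subst₂ Fin._<_ (sym (lookup-⊕ʳ i)) (sym (lookup-⊕ʳ j)) (↑ʳ-mono-< m lt)

  ⊕-cancel-<ʳ : ∀ {i j} → val (α ⊕ β) (m ↑ʳ i) < val (α ⊕ β) (m ↑ʳ j) → val β i < val β j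
  ⊕-cancel-<ʳ {i} {j} lt = ↑ʳ-cancel-< m (subst₂ Fin._<_ (lookup-⊕ʳ i) (lookup-⊕ʳ j) lt)

  ⊕-ˡ<ʳ : ∀ i j → val (α ⊕ β) (i ↑ˡ n) < val (α ⊕ β) (m ↑ʳ j)
  ⊕-ˡ<ʳ i j = subst₂ Fin._<_ (sym (lookup-⊕ˡ i)) (sym (lookup-⊕ʳ j)) (↑ˡ<↑ʳ (lookup α i) (lookup β j))

  ⊕-isPermutation⁺ : IsPermutation α → IsPermutation β → IsPermutation (α ⊕ β)
  ⊕-isPermutation⁺ α! β! = isPermutation λ {i} {j} → inj i j
    where
    inj : ∀ i j → lookup (α ⊕ β) i ≡ lookup (α ⊕ β) j → i ≡ j
    inj i j eq with split m i | split m j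
    ... | left a  | left b  = cong (_↑ˡ n) (VecUnique.lookup-injective α! a b (Fin.↑ˡ-injective n _ _
                                (trans (sym (lookup-⊕ˡ a)) (trans eq (lookup-⊕ˡ b)))))
    ... | right a | right b = cong (m ↑ʳ_) (VecUnique.lookup-injective β! a b (Fin.↑ʳ-injective m _ _
                                (trans (sym (lookup-⊕ʳ a)) (trans eq (lookup-⊕ʳ b)))))
    ... | left a  | right b = contradiction (cong toℕ eq) (ℕ.<⇒≢ (⊕-ˡ<ʳ a b))
    ... | right a | left b  = contradiction (cong toℕ (sym eq)) (ℕ.<⇒≢ (⊕-ˡ<ʳ b a))

  ⊕-isPermutation⁻ : IsPermutation (α ⊕ β) → IsPermutation α × IsPermutation β
  ⊕-isPermutation⁻ αβ! =
    (isPermutation λ {i} {j} eq → Fin.↑ˡ-injective n i j (VecUnique.lookup-injective αβ! _ _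
      (trans (lookup-⊕ˡ i) (trans (cong (_↑ˡ n) eq) (sym (lookup-⊕ˡ j)))))) ,
    (isPermutation λ {i} {j} eq → Fin.↑ʳ-injective m i j (VecUnique.lookup-injective αβ! _ _
      (trans (lookup-⊕ʳ i) (trans (cong (m ↑ʳ_) eq) (sym (lookup-⊕ʳ j))))))

  inversions-⊕ : inversions (α ⊕ β) ≡ inversions α ℕ.+ inversions β
  inversions-⊕ = begin
    inversions (α ⊕ β)                     ≡⟨ inversions-≡ (α ⊕ β) unique sound (λ {p} → complete p) ⟩
    length (withinˡ ++ withinʳ)            ≡⟨ List.length-++ withinˡ ⟩
    length withinˡ ℕ.+ length withinʳ      ≡⟨ cong₂ ℕ._+_ (List.length-map injˡ (inversionList α))
                                                (List.length-map injʳ (inversionList β)) ⟩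
    inversions α ℕ.+ inversions β          ∎
    where
    open ≡-Reasoning
    injˡ : Fin m × Fin m → Fin (m ℕ.+ n) × Fin (m ℕ.+ n)
    injˡ (i , j) = i ↑ˡ n , j ↑ˡ n
    injʳ : Fin n × Fin n → Fin (m ℕ.+ n) × Fin (m ℕ.+ n)
    injʳ (i , j) = m ↑ʳ i , m ↑ʳ j
    withinˡ withinʳ : List (Fin (m ℕ.+ n) × Fin (m ℕ.+ n))
    withinˡ = List.map injˡ (inversionList α)
    withinʳ = List.map injʳ (inversionList β)
    unique : Unique (withinˡ ++ withinʳ)
    unique = Unique.++⁺
      (Unique.map⁺ (λ eq → cong₂ _,_ (Fin.↑ˡ-injective n _ _ (cong proj₁ eq)) (Fin.↑ˡ-injective n _ _ (cong proj₂ eq)))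
        (inversionList! α))
      (Unique.map⁺ (λ eq → cong₂ _,_ (Fin.↑ʳ-injective m _ _ (cong proj₁ eq)) (Fin.↑ʳ-injective m _ _ (cong proj₂ eq)))
        (inversionList! β))
      λ (p∈ , p∈′) → case ∈-map⁻ injˡ p∈ , ∈-map⁻ injʳ p∈′ of λ { (((i , _) , _ , refl) , ((j , _) , _ , eq)) →
        ↑ˡ≢↑ʳ i j (cong proj₁ eq) }
    sound : ∀ {p} → p ∈ withinˡ ++ withinʳ → Inversion (α ⊕ β) p
    sound p∈ with ∈-++⁻ withinˡ p∈
    ... | inj₁ p∈ with _ , q∈ , refl ← ∈-map⁻ injˡ p∈ = map (↑ˡ-mono-< n) ⊕-mono-<ˡ (∈-inversionList⁻ α q∈)
    ... | inj₂ p∈ with _ , q∈ , refl ← ∈-map⁻ injʳ p∈ = map (↑ʳ-mono-< m) ⊕-mono-<ʳ (∈-inversionList⁻ β q∈)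
    complete : ∀ p → Inversion (α ⊕ β) p → p ∈ withinˡ ++ withinʳ
    complete (i , j) (i<j , lt) with split m i | split m j
    ... | left a  | left b  = ∈-++⁺ˡ (∈-map⁺ injˡ (∈-inversionList⁺ α (↑ˡ-cancel-< n i<j , ⊕-cancel-<ˡ lt)))
    ... | right a | right b = ∈-++⁺ʳ withinˡ (∈-map⁺ injʳ (∈-inversionList⁺ β (↑ʳ-cancel-< m i<j , ⊕-cancel-<ʳ lt)))
    ... | left a  | right b = contradiction lt (ℕ.<-asym (⊕-ˡ<ʳ a b))
    ... | right a | left b  = contradiction i<j (ℕ.<-asym (↑ˡ<↑ʳ b a))

  -- The 3 and the 2 form an inversion and so lie in the same summand. On the left they bring the 1
  -- along, on the right the 4.
  Has1324-⊕⁻ : Has1324 (α ⊕ β) → Has132 α ⊎ Has213 β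
  Has1324-⊕⁻ (a , b , c , d , a<b , b<c , c<d , a<′c , c<′b , b<′d) =
    go (split m a) (split m b) (split m c) (split m d) a<b b<c c<d a<′c c<′b b<′d
    where
    go : ∀ {a b c d} → Split m n a → Split m n b → Split m n c → Split m n d → a Fin.< b → b Fin.< c → c Fin.< d →
         val (α ⊕ β) a < val (α ⊕ β) c → val (α ⊕ β) c < val (α ⊕ β) b → val (α ⊕ β) b < val (α ⊕ β) d →
         Has132 α ⊎ Has213 β
    go (left a)  (left b)  (left c)  _         a<b b<c _   a<′c c<′b _    =
      inj₁ (a , b , c , ↑ˡ-cancel-< n a<b , ↑ˡ-cancel-< n b<c , ⊕-cancel-<ˡ a<′c , ⊕-cancel-<ˡ c<′b)
    go _         (right b) (right c) (right d) _   b<c c<d _    c<′b b<′d =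
      inj₂ (b , c , d , ↑ʳ-cancel-< m b<c , ↑ʳ-cancel-< m c<d , ⊕-cancel-<ʳ c<′b , ⊕-cancel-<ʳ b<′d)
    go _         (left b)  (right c) _         _   _   _   _    c<′b _    = contradiction c<′b (ℕ.<-asym (⊕-ˡ<ʳ b c))
    go _         (right b) (left c)  _         _   b<c _   _    _    _    = contradiction b<c (ℕ.<-asym (↑ˡ<↑ʳ c b))
    go (right a) (left b)  (left c)  _         a<b _   _   _    _    _    = contradiction a<b (ℕ.<-asym (↑ˡ<↑ʳ b a))
    go _         (right b) (right c) (left d)  _   _   c<d _    _    _    = contradiction c<d (ℕ.<-asym (↑ˡ<↑ʳ d c))

  -- Consecutive entries of a 4321 are inversions, and no inversion crosses the cut.
  Has4321-⊕⁻ : Has4321 (α ⊕ β) → Has4321 α ⊎ Has4321 β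
  Has4321-⊕⁻ (a , b , c , d , a<b , b<c , c<d , b<′a , c<′b , d<′c) =
    go (split m a) (split m b) (split m c) (split m d) a<b b<c c<d b<′a c<′b d<′c
    where
    go : ∀ {a b c d} → Split m n a → Split m n b → Split m n c → Split m n d → a Fin.< b → b Fin.< c → c Fin.< d →
         val (α ⊕ β) b < val (α ⊕ β) a → val (α ⊕ β) c < val (α ⊕ β) b → val (α ⊕ β) d < val (α ⊕ β) c →
         Has4321 α ⊎ Has4321 β
    go (left a)  (left b)  (left c)  (left d)  a<b b<c c<d b<′a c<′b d<′c =
      inj₁ (a , b , c , d , ↑ˡ-cancel-< n a<b , ↑ˡ-cancel-< n b<c , ↑ˡ-cancel-< n c<d ,
            ⊕-cancel-<ˡ b<′a , ⊕-cancel-<ˡ c<′b , ⊕-cancel-<ˡ d<′c)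
    go (right a) (right b) (right c) (right d) a<b b<c c<d b<′a c<′b d<′c =
      inj₂ (a , b , c , d , ↑ʳ-cancel-< m a<b , ↑ʳ-cancel-< m b<c , ↑ʳ-cancel-< m c<d ,
            ⊕-cancel-<ʳ b<′a , ⊕-cancel-<ʳ c<′b , ⊕-cancel-<ʳ d<′c)
    go (left a)  (right b) _         _         _   _   _   b<′a _    _    = contradiction b<′a (ℕ.<-asym (⊕-ˡ<ʳ a b))
    go (right a) (left b)  _         _         a<b _   _   _    _    _    = contradiction a<b (ℕ.<-asym (↑ˡ<↑ʳ b a))
    go _         (left b)  (right c) _         _   _   _   _    c<′b _    = contradiction c<′b (ℕ.<-asym (⊕-ˡ<ʳ b c))
    go _         (right b) (left c)  _         _   b<c _   _    _    _    = contradiction b<c (ℕ.<-asym (↑ˡ<↑ʳ c b))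
    go _         _         (left c)  (right d) _   _   _   _    _    d<′c = contradiction d<′c (ℕ.<-asym (⊕-ˡ<ʳ c d))
    go _         _         (right c) (left d)  _   _   c<d _    _    _    = contradiction c<d (ℕ.<-asym (↑ˡ<↑ʳ d c))

  Has4321-⊕⁺ : Has4321 α ⊎ Has4321 β → Has4321 (α ⊕ β)
  Has4321-⊕⁺ (inj₁ (a , b , c , d , a<b , b<c , c<d , b<′a , c<′b , d<′c)) =
    _ , _ , _ , _ , ↑ˡ-mono-< n a<b , ↑ˡ-mono-< n b<c , ↑ˡ-mono-< n c<d ,
    ⊕-mono-<ˡ b<′a , ⊕-mono-<ˡ c<′b , ⊕-mono-<ˡ d<′c
  Has4321-⊕⁺ (inj₂ (a , b , c , d , a<b , b<c , c<d , b<′a , c<′b , d<′c)) =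
    _ , _ , _ , _ , ↑ʳ-mono-< m a<b , ↑ʳ-mono-< m b<c , ↑ʳ-mono-< m c<d ,
    ⊕-mono-<ʳ b<′a , ⊕-mono-<ʳ c<′b , ⊕-mono-<ʳ d<′c

-- Both summands are nonempty: an entry of `β` serves as the 4 above a 132 in `α`, an entry of `α`
-- as the 1 below a 213 in `β`.
Has1324-⊕⁺ : (α : Word (suc m)) (β : Word (suc n)) → Has132 α ⊎ Has213 β → Has1324 (α ⊕ β)
Has1324-⊕⁺ {m} {n} α β (inj₁ (a , b , c , a<b , b<c , a<′c , c<′b)) =
  _ , _ , _ , _ , ↑ˡ-mono-< (suc n) a<b , ↑ˡ-mono-< (suc n) b<c , ↑ˡ<↑ʳ c zero ,
  ⊕-mono-<ˡ α β a<′c , ⊕-mono-<ˡ α β c<′b , ⊕-ˡ<ʳ α β b zero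
Has1324-⊕⁺ {m} {n} α β (inj₂ (a , b , c , a<b , b<c , b<′a , a<′c)) =
  _ , _ , _ , _ , ↑ˡ<↑ʳ zero a , ↑ʳ-mono-< (suc m) a<b , ↑ʳ-mono-< (suc m) b<c ,
  ⊕-ˡ<ʳ α β zero b , ⊕-mono-<ʳ α β b<′a , ⊕-mono-<ʳ α β a<′c

-- Avoiders of 1324 with few inversions

-- Pairs of the forms `(a , q s)` and `(q t , b)` can coincide only as `(a , b)`, which is excluded
-- when `q` misses `a` or misses `b`. So distinct positions give distinct inversions.
inversions-through : ∀ (π : Word n) {a b} (q : Fin k → Fin n) → (∀ {s t} → q s ≡ q t → s ≡ t) →
                     (∀ t → q t ≢ a) ⊎ (∀ t → q t ≢ b) →
                     (∀ t → Inversion π (a , q t) ⊎ Inversion π (q t , b)) → k ≤ inversions π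
inversions-through {n} {k} π {a} {b} q q-inj avoided inv =
  inversions-≥ π pair (λ {s} {t} → pair-injective s t) pair-inversion
  where
  pair : Fin k → Fin n × Fin n
  pair t = [ (λ _ → a , q t) , (λ _ → q t , b) ]′ (inv t)
  pair-injective : ∀ s t → pair s ≡ pair t → s ≡ t
  pair-injective s t eq with inv s | inv t
  ... | inj₁ _ | inj₁ _ = q-inj (cong proj₂ eq)
  ... | inj₂ _ | inj₂ _ = q-inj (cong proj₁ eq)
  ... | inj₁ _ | inj₂ _ = ⊥-elim ([ (λ q≢a → q≢a t (sym (cong proj₁ eq))) , (λ q≢b → q≢b s (cong proj₂ eq)) ]′ avoided)
  ... | inj₂ _ | inj₁ _ = ⊥-elim ([ (λ q≢a → q≢a s (cong proj₁ eq)) , (λ q≢b → q≢b t (sym (cong proj₂ eq))) ]′ avoided)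
  pair-inversion : ∀ t → Inversion π (pair t)
  pair-inversion t with inv t
  ... | inj₁ i = i
  ... | inj₂ i = i

-- If (a , b) is an inversion, avoiding 1324 prevents that both some entry before a is
-- smaller than π b and some entry after b is larger than π a. So a and b together
-- form inversions with all entries after a, or with all entries before b.
no-crossing-inversion : ∀ (π : Word (m ℕ.+ n)) → IsPermutation π → ¬ Has1324 π → inversions π < m → inversions π < n →
                        ∀ i j → val π (i ↑ˡ n) < val π (m ↑ʳ j)
no-crossing-inversion {m} {n} π π! av inv<m inv<n i j = ℕ.≰⇒> (crossing ∘ strict)
  where
  N = m ℕ.+ n
  a b : Fin N
  a = i ↑ˡ n
  b = m ↑ʳ j
  ≢⇒< : ∀ {p q} → p ≢ q → val π p ≤ val π q → val π p < val π q
  ≢⇒< p≢q p≤q = ℕ.≤∧≢⇒< p≤q (p≢q ∘ val-injective π!)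
  strict : val π b ≤ val π a → val π b < val π a
  strict = ≢⇒< (↑ˡ≢↑ʳ i j ∘ sym)
  crossing : ¬ (val π b < val π a)
  crossing b<′a with Fin.any? (λ p → (p Fin.<? a) ×-dec (val π p ℕ.<? val π b))
  ... | yes (p , p<a , p<′b) = ℕ.1+n≰n (inversions-through π {a} {b} q
          (λ eq → Fin.inject≤-injective inv<n inv<n _ _ (Fin.↑ʳ-injective m _ _ eq))
          (inj₁ λ t → ↑ˡ≢↑ʳ i _ ∘ sym) inv)
    where
    -- Entries behind the cut are all behind `a`, and there are more of them than inversions.
    q : Fin (suc (inversions π)) → Fin N
    q t = m ↑ʳ inject≤ t inv<n
    inv : ∀ t → Inversion π (a , q t) ⊎ Inversion π (q t , b)
    inv t with val π (q t) ℕ.<? val π a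
    ... | yes q<′a = inj₁ (↑ˡ<↑ʳ i _ , q<′a)
    ... | no  q≮′a with Fin.<-cmp (q t) b
    ...   | tri< q<b _ _ = inj₂ (q<b , ℕ.<-≤-trans b<′a (ℕ.≮⇒≥ q≮′a))
    ...   | tri≈ _ q≡b _ = contradiction (subst (λ x → val π x < val π a) (sym q≡b) b<′a) q≮′a
    ...   | tri> _ _ b<q = contradiction (p , a , b , q t , p<a , ↑ˡ<↑ʳ i j , b<q , p<′b , b<′a ,
                                          ≢⇒< (↑ˡ≢↑ʳ i _) (ℕ.≮⇒≥ q≮′a)) av
  ... | no  ∄p = ℕ.1+n≰n (inversions-through π {a} {b} q
          (λ eq → Fin.inject≤-injective inv<m inv<m _ _ (Fin.↑ˡ-injective n _ _ eq))
          (inj₂ λ t → ↑ˡ≢↑ʳ _ j) inv)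
    where
    -- Entries in front of the cut are all in front of `b`, and again there are more of them than
    -- inversions.
    q : Fin (suc (inversions π)) → Fin N
    q t = inject≤ t inv<m ↑ˡ n
    inv : ∀ t → Inversion π (a , q t) ⊎ Inversion π (q t , b)
    inv t with val π b ℕ.<? val π (q t)
    ... | yes b<′q = inj₂ (↑ˡ<↑ʳ _ j , b<′q)
    ... | no  b≮′q with Fin.<-cmp a (q t)
    ...   | tri< a<q _ _ = inj₁ (a<q , ℕ.≤-<-trans (ℕ.≮⇒≥ b≮′q) b<′a)
    ...   | tri≈ _ a≡q _ = contradiction (subst (λ x → val π b < val π x) a≡q b<′a) b≮′q
    ...   | tri> _ _ q<a = contradiction (q t , q<a , ≢⇒< (↑ˡ≢↑ʳ _ j) (ℕ.≮⇒≥ b≮′q)) ∄p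

split-< : ∀ (x : Fin (m ℕ.+ n)) → toℕ x < m → ∃[ v ] x ≡ v ↑ˡ n
split-< {m} x x<m with split m x
... | left v  = v , refl
... | right w = contradiction (subst (_< m) (Fin.toℕ-↑ʳ m w) x<m) (ℕ.m+n≮m m _)

split-≥ : ∀ (x : Fin (m ℕ.+ n)) → m ≤ toℕ x → ∃[ w ] x ≡ m ↑ʳ w
split-≥ {m} {n} x m≤x with split m x
... | left v  = contradiction (Fin.toℕ<n v) (ℕ.≤⇒≯ (subst (m ≤_) (Fin.toℕ-↑ˡ v n) m≤x))
... | right w = w , refl

pigeonhole-< : (x : Fin k → Fin (m ℕ.+ n)) → (∀ {s t} → x s ≡ x t → s ≡ t) → (∀ t → toℕ (x t) < m) → k ≤ m
pigeonhole-< {n = n} x x-inj x<m = Fin.injective⇒≤ {f = λ t → proj₁ (split-< (x t) (x<m t))} λ {s} {t} eq →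
  x-inj (trans (proj₂ (split-< (x s) (x<m s))) (trans (cong (_↑ˡ n) eq) (sym (proj₂ (split-< (x t) (x<m t))))))

pigeonhole-≥ : (x : Fin k → Fin (m ℕ.+ n)) → (∀ {s t} → x s ≡ x t → s ≡ t) → (∀ t → m ≤ toℕ (x t)) → k ≤ n
pigeonhole-≥ {m = m} x x-inj m≤x = Fin.injective⇒≤ {f = λ t → proj₁ (split-≥ (x t) (m≤x t))} λ {s} {t} eq →
  x-inj (trans (proj₂ (split-≥ (x s) (m≤x s))) (trans (cong (m ↑ʳ_) eq) (sym (proj₂ (split-≥ (x t) (m≤x t))))))

-- A left entry of value at least `m`, together with the `n` larger entries on the right, would make
-- `suc n` entries for only `n` values. The argument for a right entry below `m` is symmetric.
⊕-decompose : ∀ (π : Word (m ℕ.+ n)) → IsPermutation π → (∀ i j → val π (i ↑ˡ n) < val π (m ↑ʳ j)) →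
              ∃[ α ] ∃[ β ] π ≡ α ⊕ β
⊕-decompose {m} {n} π π! ˡ<ʳ = α , β , vec-ext π≗
  where
  π-inj : ∀ {i j} → lookup π i ≡ lookup π j → i ≡ j
  π-inj = VecUnique.lookup-injective π! _ _
  small : ∀ i → val π (i ↑ˡ n) < m
  small i = ℕ.≰⇒> λ m≤ → ℕ.1+n≰n (pigeonhole-≥ {m = m} {n} (lookup π ∘ position) (λ eq → position-inj _ _ (π-inj eq))
    λ { zero → m≤ ; (suc j) → ℕ.≤-trans m≤ (ℕ.<⇒≤ (ˡ<ʳ i j)) })
    where
    position : Fin (suc n) → Fin (m ℕ.+ n)
    position zero    = i ↑ˡ n
    position (suc j) = m ↑ʳ j
    position-inj : ∀ s t → position s ≡ position t → s ≡ t
    position-inj zero    zero    _  = refl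
    position-inj zero    (suc t) eq = contradiction eq (↑ˡ≢↑ʳ i t)
    position-inj (suc s) zero    eq = contradiction (sym eq) (↑ˡ≢↑ʳ i s)
    position-inj (suc s) (suc t) eq = cong suc (Fin.↑ʳ-injective m s t eq)
  large : ∀ j → m ≤ val π (m ↑ʳ j)
  large j = ℕ.≮⇒≥ λ <m → ℕ.1+n≰n (pigeonhole-< {m = m} {n} (lookup π ∘ position) (λ eq → position-inj _ _ (π-inj eq))
    λ { zero → <m ; (suc i) → ℕ.<-trans (ˡ<ʳ i j) <m })
    where
    position : Fin (suc m) → Fin (m ℕ.+ n)
    position zero    = m ↑ʳ j
    position (suc i) = i ↑ˡ n
    position-inj : ∀ s t → position s ≡ position t → s ≡ t
    position-inj zero    zero    _  = refl
    position-inj zero    (suc t) eq = contradiction (sym eq) (↑ˡ≢↑ʳ t j)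
    position-inj (suc s) zero    eq = contradiction eq (↑ˡ≢↑ʳ s j)
    position-inj (suc s) (suc t) eq = cong suc (Fin.↑ˡ-injective n s t eq)
  splitˡ : ∀ i → ∃[ v ] lookup π (i ↑ˡ n) ≡ v ↑ˡ n
  splitˡ i = split-< (lookup π (i ↑ˡ n)) (small i)
  splitʳ : ∀ j → ∃[ w ] lookup π (m ↑ʳ j) ≡ m ↑ʳ w
  splitʳ j = split-≥ (lookup π (m ↑ʳ j)) (large j)
  α : Word m
  α = Vec.tabulate (proj₁ ∘ splitˡ)
  β : Word n
  β = Vec.tabulate (proj₁ ∘ splitʳ)
  π≗ : ∀ i → lookup π i ≡ lookup (α ⊕ β) i
  π≗ i with split m i
  ... | left i  = trans (proj₂ (splitˡ i)) (sym (trans (lookup-⊕ˡ α β i) (cong (_↑ˡ n) (Vec.lookup∘tabulate _ i))))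
  ... | right j = trans (proj₂ (splitʳ j)) (sym (trans (lookup-⊕ʳ α β j) (cong (m ↑ʳ_) (Vec.lookup∘tabulate _ j))))

-- Reverse complement

rc : Word n → Word n
rc π = Vec.tabulate (opposite ∘ lookup π ∘ opposite)

lookup-rc : ∀ (π : Word n) i → lookup (rc π) i ≡ opposite (lookup π (opposite i))
lookup-rc π = Vec.lookup∘tabulate _

rc-involutive : (π : Word n) → rc (rc π) ≡ π
rc-involutive π = vec-ext λ i → trans (lookup-rc (rc π) i) (trans (cong opposite (lookup-rc π (opposite i)))
  (trans (Fin.opposite-involutive _) (cong (lookup π) (Fin.opposite-involutive i))))

opposite-anti-< : ∀ {i j : Fin n} → i Fin.< j → opposite j Fin.< opposite i
opposite-anti-< {n} {i} {j} i<j = subst₂ _<_ (sym (Fin.opposite-prop j)) (sym (Fin.opposite-prop i))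
  (ℕ.∸-monoʳ-< (s≤s i<j) (Fin.toℕ<n j))

opposite-injective : ∀ {i j : Fin n} → opposite i ≡ opposite j → i ≡ j
opposite-injective {i = i} {j} eq =
  trans (sym (Fin.opposite-involutive i)) (trans (cong opposite eq) (Fin.opposite-involutive j))

rc-isPermutation : (π : Word n) → IsPermutation π → IsPermutation (rc π)
rc-isPermutation π π! = isPermutation λ {i} {j} eq → opposite-injective (VecUnique.lookup-injective π! _ _
  (opposite-injective (trans (sym (lookup-rc π i)) (trans eq (lookup-rc π j)))))

rc-anti-< : ∀ (π : Word n) {i j} → val (rc π) i < val (rc π) j → val π (opposite j) < val π (opposite i)
rc-anti-< π {i} {j} lt = subst₂ Fin._<_ (Fin.opposite-involutive _) (Fin.opposite-involutive _)
  (opposite-anti-< (subst₂ Fin._<_ (lookup-rc π i) (lookup-rc π j) lt))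

Inversion-rc : ∀ (π : Word n) {i j} → Inversion (rc π) (i , j) → Inversion π (opposite j , opposite i)
Inversion-rc π (i<j , lt) = opposite-anti-< i<j , rc-anti-< π lt

inversions-rc-≤ : (π : Word n) → inversions (rc π) ≤ inversions π
inversions-rc-≤ {n} π = subst (_≤ inversions π) (List.length-map flip (inversionList (rc π)))
  (length-mono-⊆ (Unique.map⁺ flip-injective (inversionList! (rc π))) λ p∈ →
    case ∈-map⁻ flip p∈ of λ { (_ , q∈ , refl) → ∈-inversionList⁺ π (Inversion-rc π (∈-inversionList⁻ (rc π) q∈)) })
  where
  flip : Fin n × Fin n → Fin n × Fin n
  flip (i , j) = opposite j , opposite i
  flip-injective : ∀ {p q} → flip p ≡ flip q → p ≡ q
  flip-injective eq = cong₂ _,_ (opposite-injective (cong proj₂ eq)) (opposite-injective (cong proj₁ eq))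

inversions-rc : (π : Word n) → inversions (rc π) ≡ inversions π
inversions-rc π = ℕ.≤-antisym (inversions-rc-≤ π)
  (subst (λ σ → inversions σ ≤ inversions (rc π)) (rc-involutive π) (inversions-rc-≤ (rc π)))

Has213-rc : (π : Word n) → Has213 (rc π) → Has132 π
Has213-rc π (a , b , c , a<b , b<c , b<′a , a<′c) =
  _ , _ , _ , opposite-anti-< b<c , opposite-anti-< a<b , rc-anti-< π a<′c , rc-anti-< π b<′a

Has132-rc : (π : Word n) → Has132 (rc π) → Has213 π
Has132-rc π (a , b , c , a<b , b<c , a<′c , c<′b) =
  _ , _ , _ , opposite-anti-< b<c , opposite-anti-< a<b , rc-anti-< π c<′b , rc-anti-< π a<′c

Has4321-rc : (π : Word n) → Has4321 (rc π) → Has4321 π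
Has4321-rc π (a , b , c , d , a<b , b<c , c<d , b<′a , c<′b , d<′c) =
  _ , _ , _ , _ , opposite-anti-< c<d , opposite-anti-< b<c , opposite-anti-< a<b ,
  rc-anti-< π d<′c , rc-anti-< π c<′b , rc-anti-< π b<′a

-- Pattern containment

-- As the letters of `v` are distinct, trichotomy in `v` turns monotonicity into reflection of the
-- order.
orderIsomorphic⁺ : ∀ (u : Vec (Fin n) m) (v : Vec (Fin k) m) → (∀ i j → lookup v i ≡ lookup v j → i ≡ j) →
                   (∀ i j → lookup v i Fin.< lookup v j → lookup u i Fin.< lookup u j) → OrderIsomorphic u v
orderIsomorphic⁺ u v v-inj mono i j = mk⇔ reflect (mono i j)
  where
  reflect : lookup u i Fin.< lookup u j → lookup v i Fin.< lookup v j
  reflect ui<uj with Fin.<-cmp (lookup v i) (lookup v j)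
  ... | tri< vi<vj _ _ = vi<vj
  ... | tri≈ _ vi≡vj _ = contradiction (cong (toℕ ∘ lookup u) (v-inj i j vi≡vj)) (ℕ.<⇒≢ ui<uj)
  ... | tri> _ _ vj<vi = contradiction ui<uj (ℕ.<-asym (mono j i vj<vi))

-- For a concrete pattern this list evaluates, so `ascents⁻` asks for six inequalities when `v` is a
-- permutation of length four, instead of a case distinction over all pairs.
ascents : (v : Vec (Fin k) m) → List (Fin m × Fin m)
ascents {m = m} v = filter (λ (i , j) → lookup v i Fin.<? lookup v j) (cartesianProduct (allFin m) (allFin m))

ascents⁻ : ∀ (u : Vec (Fin n) m) (v : Vec (Fin k) m) → All.All (λ (i , j) → lookup u i Fin.< lookup u j) (ascents v) →
           ∀ i j → lookup v i Fin.< lookup v j → lookup u i Fin.< lookup u j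
ascents⁻ u v ascends i j vi<vj = All.lookup ascends
  (∈-filter⁺ (λ (i , j) → lookup v i Fin.<? lookup v j) (∈-cartesianProduct⁺ (∈-allFin i) (∈-allFin j)) vi<vj)

increasing : ∀ {a b c d : Fin n} → a Fin.< b → b Fin.< c → c Fin.< d → VecAllPairs.AllPairs Fin._<_ (a ∷ b ∷ c ∷ d ∷ [])
increasing a<b b<c c<d =
  (a<b ∷ ℕ.<-trans a<b b<c ∷ ℕ.<-trans a<b (ℕ.<-trans b<c c<d) ∷ []) ∷
  (b<c ∷ ℕ.<-trans b<c c<d ∷ []) ∷ (c<d ∷ []) ∷ [] ∷ []

avoids1324⁺ : ∀ (π : Word n) → ¬ Has1324 π → Avoids π p1324
avoids1324⁺ π ¬has (_ ∷ _ ∷ _ ∷ _ ∷ [] , (a<b ∷ _) ∷ (b<c ∷ _) ∷ (c<d ∷ _) ∷ _ , iso) =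
  ¬has (_ , _ , _ , _ , a<b , b<c , c<d ,
        Equivalence.from (iso 0F 2F) z<s , Equivalence.from (iso 2F 1F) (s<s z<s) ,
        Equivalence.from (iso 1F 3F) (s<s (s<s z<s)))

avoids4321⁺ : ∀ (π : Word n) → ¬ Has4321 π → Avoids π p4321
avoids4321⁺ π ¬has (_ ∷ _ ∷ _ ∷ _ ∷ [] , (a<b ∷ _) ∷ (b<c ∷ _) ∷ (c<d ∷ _) ∷ _ , iso) =
  ¬has (_ , _ , _ , _ , a<b , b<c , c<d ,
        Equivalence.from (iso 1F 0F) (s<s (s<s z<s)) , Equivalence.from (iso 2F 1F) (s<s z<s) ,
        Equivalence.from (iso 3F 2F) z<s)

avoids1324⁻ : ∀ (π : Word n) → Avoids π p1324 → ¬ Has1324 π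
avoids1324⁻ π av (a , b , c , d , a<b , b<c , c<d , a<′c , c<′b , b<′d) =
  av (is , increasing a<b b<c c<d , orderIsomorphic⁺ u v (VecUnique.lookup-injective (from-yes (isPermutation? v)))
    -- The inequalities stand in the order of `ascents v`, lexicographic in the positions.
    (ascents⁻ u v (ℕ.<-trans a<′c c<′b ∷ a<′c ∷ ℕ.<-trans a<′c (ℕ.<-trans c<′b b<′d) ∷
                  b<′d ∷ c<′b ∷ ℕ.<-trans c<′b b<′d ∷ [])))
  where
  is = a ∷ b ∷ c ∷ d ∷ []
  u = Vec.map (lookup π) is
  v = proj₂ p1324

avoids4321⁻ : ∀ (π : Word n) → Avoids π p4321 → ¬ Has4321 π
avoids4321⁻ π av (a , b , c , d , a<b , b<c , c<d , b<′a , c<′b , d<′c) =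
  av (is , increasing a<b b<c c<d , orderIsomorphic⁺ u v (VecUnique.lookup-injective (from-yes (isPermutation? v)))
    (ascents⁻ u v (b<′a ∷ ℕ.<-trans c<′b b<′a ∷ c<′b ∷
                  ℕ.<-trans d<′c (ℕ.<-trans c<′b b<′a) ∷ ℕ.<-trans d<′c c<′b ∷ d<′c ∷ [])))
  where
  is = a ∷ b ∷ c ∷ d ∷ []
  u = Vec.map (lookup π) is
  v = proj₂ p4321

Descending-≤ : ∀ {i j lo hi} {π : Word n} → j ≤ i → Descending i lo hi π → Descending j lo hi π
Descending-≤ z≤n       _                  = tt
Descending-≤ (s≤s j≤i) (p , lo≤p , lt , d) = p , lo≤p , lt , Descending-≤ j≤i d

Has4321⇒Descending : ∀ (π : Word n) → Has4321 π → Descending 4 0 n π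
Has4321⇒Descending π (a , b , c , d , a<b , b<c , c<d , b<′a , c<′b , d<′c) =
  a , z≤n , Fin.toℕ<n (lookup π a) , b , a<b , b<′a , c , b<c , c<′b , d , c<d , d<′c , tt

Descending⇒Has4321 : ∀ (π : Word n) → Descending 4 0 n π → Has4321 π
Descending⇒Has4321 π (a , _ , _ , b , a<b , b<′a , c , b<c , c<′b , d , c<d , d<′c , _) =
  a , b , c , d , a<b , b<c , c<d , b<′a , c<′b , d<′c

-- Partitions and 132-avoiding permutations

largest : List ℕ → ℕ
largest []      = 0
largest (c ∷ _) = c

-- Partition j cs: cs is a weakly decreasing list of positive parts of exactly j different sizes.
data Partition : ℕ → List ℕ → Set where
  empty  : Partition 0 []
  again  : ∀ {j c cs} → Partition (suc j) (c ∷ cs) → Partition (suc j) (c ∷ c ∷ cs)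
  larger : ∀ {j c cs} → largest cs < c → Partition j cs → Partition (suc j) (c ∷ cs)

part-positive : ∀ {j c cs} → Partition j (c ∷ cs) → 0 < c
part-positive (again p)    = part-positive p
part-positive (larger c> _) = ℕ.≤-<-trans z≤n c>

-- The Lehmer code of a permutation of length m may start with cs.
Fits : ℕ → List ℕ → Set
Fits m       []       = ⊤
Fits zero    (_ ∷ _)  = ⊥
Fits (suc m) (c ∷ cs) = c ≤ m × Fits m cs

-- No part exceeds the sum, and since parts are positive, dropping one lowers the sum by at least as
-- much as the available length.
sum<⇒Fits : ∀ {j cs} → Partition j cs → sum cs < m → Fits m cs
sum<⇒Fits empty _ = tt
sum<⇒Fits {m = suc m} {cs = c ∷ cs} p (s≤s le) = ℕ.≤-trans (ℕ.m≤m+n c (sum cs)) le , fits p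
  where
  sum<m : 0 < c → sum cs < m
  sum<m 0<c = ℕ.≤-trans (ℕ.+-monoˡ-≤ (sum cs) 0<c) le
  fits : Partition _ (c ∷ cs) → Fits m cs
  fits (again q)     = sum<⇒Fits q (sum<m (part-positive q))
  fits (larger c> q) = sum<⇒Fits q (sum<m (ℕ.≤-<-trans z≤n c>))

clamp : ℕ → Fin (suc m)
clamp {m} c = fromℕ< (s≤s (ℕ.m⊓n≤n c m))

toℕ-clamp : ∀ {c} → c ≤ m → toℕ (clamp {m} c) ≡ c
toℕ-clamp c≤m = trans (Fin.toℕ-fromℕ< _) (ℕ.m≤n⇒m⊓n≡m c≤m)

-- The permutation with Lehmer code cs, padded with zeros. If cs does not fit, entries are
-- clamped or dropped.
decode : ∀ m → List ℕ → Word m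
decode zero    _        = []
decode (suc m) []       = insert zero (decode m [])
decode (suc m) (c ∷ cs) = insert (clamp c) (decode m cs)

decode-isPermutation : ∀ m cs → IsPermutation (decode m cs)
decode-isPermutation zero    _        = []
decode-isPermutation (suc m) []       = insert-isPermutation zero (decode-isPermutation m [])
decode-isPermutation (suc m) (c ∷ cs) = insert-isPermutation (clamp c) (decode-isPermutation m cs)

first-decode : ∀ m cs → Fits m cs → first (decode m cs) ≡ largest cs
first-decode zero    []       _         = refl
first-decode (suc m) []       _         = refl
first-decode (suc m) (c ∷ cs) (c≤m , _) = toℕ-clamp c≤m

inversions-decode : ∀ m cs → Fits m cs → inversions (decode m cs) ≡ sum cs
inversions-decode zero    []       _          = refl
inversions-decode (suc m) []       _          =
  trans (inversions-insert zero (decode m []) (decode-isPermutation m [])) (inversions-decode m [] tt)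
inversions-decode (suc m) (c ∷ cs) (c≤m , fits) =
  trans (inversions-insert (clamp c) (decode m cs) (decode-isPermutation m cs))
        (cong₂ ℕ._+_ (toℕ-clamp c≤m) (inversions-decode m cs fits))

-- The first letter is the first code entry, and padding cannot be mistaken for a part because parts
-- are positive.
decode-injective : ∀ m {i j cs ds} → Partition i cs → Partition j ds → Fits m cs → Fits m ds →
                   decode m cs ≡ decode m ds → cs ≡ ds
decode-injective _       empty empty _ _ _ = refl
decode-injective (suc m) {ds = d ∷ ds} empty q _ (d≤m , _) eq = contradiction (part-positive q)
  (ℕ.<-irrefl (trans (cong toℕ (Vec.∷-injectiveˡ eq)) (toℕ-clamp d≤m)))
decode-injective (suc m) {cs = c ∷ cs} p empty (c≤m , _) _ eq = contradiction (part-positive p)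
  (ℕ.<-irrefl (sym (trans (sym (toℕ-clamp c≤m)) (cong toℕ (Vec.∷-injectiveˡ eq)))))
decode-injective (suc m) {cs = c ∷ cs} {d ∷ ds} p q (c≤m , fc) (d≤m , fd) eq
  with refl ← trans (sym (toℕ-clamp c≤m)) (trans (cong toℕ (Vec.∷-injectiveˡ eq)) (toℕ-clamp d≤m)) =
  cong (c ∷_) (decode-injective m (proj₂ (tail p)) (proj₂ (tail q)) fc fd
    (vec-map-injective (Fin.punchIn-injective (clamp c) _ _) (Vec.∷-injectiveʳ eq)))
  where
  tail : ∀ {j c cs} → Partition j (c ∷ cs) → ∃[ i ] Partition i cs
  tail (again p)    = _ , p
  tail (larger _ p) = _ , p

decode-avoids132 : ∀ m {j cs} → Partition j cs → Fits m cs → ¬ Has132 (decode m cs)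
decode-avoids132 zero    _ _ (() , _)
decode-avoids132 (suc m) empty _ = insert-avoids132 zero (decode-isPermutation m [])
  (ℕ.≤-reflexive (first-decode m [] tt)) (decode-avoids132 m empty tt)
decode-avoids132 (suc m) {cs = c ∷ cs} (again p) (c≤m , fits) = insert-avoids132 (clamp c) (decode-isPermutation m cs)
  (ℕ.≤-reflexive (trans (first-decode m cs fits) (sym (toℕ-clamp c≤m)))) (decode-avoids132 m p fits)
decode-avoids132 (suc m) {cs = c ∷ cs} (larger c> p) (c≤m , fits) = insert-avoids132 (clamp c) (decode-isPermutation m cs)
  (subst₂ _≤_ (sym (first-decode m cs fits)) (sym (toℕ-clamp c≤m)) (ℕ.<⇒≤ c>)) (decode-avoids132 m p fits)

-- The padding alone gives the increasing word. A repeated part does not lengthen decreasing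
-- subsequences, and a larger part adds at most one entry.
decode-Descending⁻ : ∀ m {j cs} → Partition j cs → Fits m cs → ¬ Descending (2 ℕ.+ j) 0 m (decode m cs)
decode-Descending⁻ zero    _ _ (() , _)
decode-Descending⁻ (suc m) empty _ d =
  decode-Descending⁻ m empty tt (Descending-insert-≡⁻ zero 0 (first-decode m [] tt) d)
decode-Descending⁻ (suc m) {cs = c ∷ cs} (again p) (c≤m , fits) d =
  decode-Descending⁻ m p fits (Descending-insert-≡⁻ (clamp c) _ (trans (first-decode m cs fits) (sym (toℕ-clamp c≤m))) d)
decode-Descending⁻ (suc m) {cs = c ∷ cs} (larger _ p) (_ , fits) d =
  decode-Descending⁻ m p fits (Descending-insert-<⁻ (clamp c) _ d)

-- With the upper bound, the longest decreasing subsequence has exactly `1 + j` entries. The word is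
-- nonempty so that even the empty partition provides one.
decode-Descending⁺ : ∀ m {j cs} → Partition j cs → Fits (suc m) cs → Descending (1 ℕ.+ j) 0 (suc m) (decode (suc m) cs)
decode-Descending⁺ m empty _ = zero , z≤n , z<s , tt
decode-Descending⁺ (suc m) {suc j} {c ∷ cs} (again p) (_ , fits) =
  Descending-insert-≡⁺ (clamp c) (2 ℕ.+ j) (decode-Descending⁺ m p fits)
decode-Descending⁺ zero {cs = zero ∷ []} (larger () _) _
decode-Descending⁺ (suc m) {suc j} {c ∷ cs} (larger c> p) (c≤m , fits) =
  Descending-insert-<⁺ (clamp c) j (decode-isPermutation (suc m) cs) (decode-avoids132 (suc m) p fits)
    (subst₂ _<_ (sym (first-decode (suc m) cs fits)) (sym (toℕ-clamp c≤m)) c>) (decode-Descending⁺ m p fits)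

decode-surjective : ∀ m (π : Word m) → IsPermutation π → ¬ Has132 π →
                    ∃[ j ] ∃[ cs ] Partition j cs × Fits m cs × π ≡ decode m cs
decode-surjective zero    []  _  _  = 0 , [] , empty , tt , refl
decode-surjective (suc m) π π! av with c , ρ , refl , ρ! ← insert-surjective π π!
  with j , cs , p , fits , refl ← decode-surjective m ρ ρ! (av ∘ Has132-insert c) =
  extend p fits (subst (_≤ toℕ c) (first-decode m cs fits) (avoids132⇒first≤ c ρ! av))
  where
  clamp-toℕ : clamp (toℕ c) ≡ c
  clamp-toℕ = Fin.toℕ-injective (toℕ-clamp (ℕ.≤-pred (Fin.toℕ<n c)))
  extend : ∀ {j cs} → Partition j cs → Fits m cs → largest cs ≤ toℕ c →
           ∃[ i ] ∃[ ds ] Partition i ds × Fits (suc m) ds × insert c (decode m cs) ≡ decode (suc m) ds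
  extend {j} {cs} p fits ≤c with ℕ.m≤n⇒m<n∨m≡n ≤c
  ... | inj₁ <c = suc j , toℕ c ∷ cs , larger <c p , (ℕ.≤-pred (Fin.toℕ<n c) , fits) ,
                  cong (λ x → insert x (decode m cs)) (sym clamp-toℕ)
  -- A zero in front of the empty code is padding and not a new part.
  extend empty fits _ | inj₂ 0≡c =
    0 , [] , empty , tt , cong (λ x → insert x (decode m [])) (Fin.toℕ-injective {j = zero} (sym 0≡c))
  extend {cs = d ∷ ds} (again p) fits _ | inj₂ refl = _ , _ , again (again p) , (ℕ.≤-pred (Fin.toℕ<n c) , fits) ,
                  cong (λ x → insert x (decode m (d ∷ ds))) (sym clamp-toℕ)
  extend {cs = d ∷ ds} (larger d> p) fits _ | inj₂ refl = _ , _ , again (larger d> p) , (ℕ.≤-pred (Fin.toℕ<n c) , fits) ,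
                  cong (λ x → insert x (decode m (d ∷ ds))) (sym clamp-toℕ)

-- Avoiders as pairs of partitions

-- The bound comes from 4321: with `j` part sizes the longest decreasing subsequence has `1 + j`
-- entries, and this has to stay below 4.
AtMostTwoSizes : List ℕ → Set
AtMostTwoSizes cs = ∃[ j ] j ≤ 2 × Partition j cs

patterns : List Pattern
patterns = p1324 ∷ p4321 ∷ []

encode : ∀ m n → List ℕ × List ℕ → Word (m ℕ.+ n)
encode m n (cs , ds) = decode m cs ⊕ rc (decode n ds)

decode-avoids4321 : ∀ m {cs} → AtMostTwoSizes cs → Fits m cs → ¬ Has4321 (decode m cs)
decode-avoids4321 m (_ , j≤2 , p) fits has =
  decode-Descending⁻ m p fits (Descending-≤ (ℕ.+-monoʳ-≤ 2 j≤2) (Has4321⇒Descending (decode m _) has))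

decode-surjective₂ : ∀ m (π : Word (suc m)) → IsPermutation π → ¬ Has132 π → ¬ Has4321 π →
                     ∃[ cs ] AtMostTwoSizes cs × sum cs ≡ inversions π × π ≡ decode (suc m) cs
decode-surjective₂ m π π! av132 av4321 with j , cs , p , fits , π≡ ← decode-surjective (suc m) π π! av132 =
  cs , (j , j≤2 , p) , trans (sym (inversions-decode (suc m) cs fits)) (cong inversions (sym π≡)) , π≡
  where
  j≤2 : j ≤ 2
  j≤2 = ℕ.≮⇒≥ λ 2<j → av4321 (Descending⇒Has4321 π (Descending-≤ (s≤s 2<j)
    (subst (Descending (suc j) 0 (suc m)) (sym π≡) (decode-Descending⁺ m p fits))))

encode-counted : ∀ {cs ds} → k < m → k < n → AtMostTwoSizes cs → AtMostTwoSizes ds → sum cs ℕ.+ sum ds ≡ k →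
                 Counted patterns (m ℕ.+ n) k (encode m n (cs , ds))
encode-counted {k} {m} {n} {cs} {ds} k<m k<n p@(_ , _ , pc) q@(_ , _ , pd) sum≡k =
  ⊕-isPermutation⁺ α β (decode-isPermutation m cs) (rc-isPermutation γ (decode-isPermutation n ds)) ,
  (begin
    inversions (α ⊕ β)                     ≡⟨ inversions-⊕ α β ⟩
    inversions α ℕ.+ inversions β          ≡⟨ cong (inversions α ℕ.+_) (inversions-rc γ) ⟩
    inversions α ℕ.+ inversions γ          ≡⟨ cong₂ ℕ._+_ (inversions-decode m cs fc) (inversions-decode n ds fd) ⟩
    sum cs ℕ.+ sum ds                      ≡⟨ sum≡k ⟩
    k                                      ∎) ,
  avoids1324⁺ (α ⊕ β) ([ decode-avoids132 m pc fc , decode-avoids132 n pd fd ∘ Has213-rc γ ]′ ∘ Has1324-⊕⁻ α β) ∷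
  avoids4321⁺ (α ⊕ β) ([ decode-avoids4321 m p fc , decode-avoids4321 n q fd ∘ Has4321-rc γ ]′ ∘ Has4321-⊕⁻ α β) ∷ []
  where
  open ≡-Reasoning
  fc : Fits m cs
  fc = sum<⇒Fits pc (ℕ.≤-<-trans (ℕ.≤-trans (ℕ.m≤m+n _ _) (ℕ.≤-reflexive sum≡k)) k<m)
  fd : Fits n ds
  fd = sum<⇒Fits pd (ℕ.≤-<-trans (ℕ.≤-trans (ℕ.m≤n+m _ _) (ℕ.≤-reflexive sum≡k)) k<n)
  α : Word m
  α = decode m cs
  γ β : Word n
  γ = decode n ds
  β = rc γ

counted⇒encode : k < m → k < n → ∀ (π : Word (m ℕ.+ n)) → Counted patterns (m ℕ.+ n) k π →
                 ∃[ cs ] ∃[ ds ] AtMostTwoSizes cs × AtMostTwoSizes ds × sum cs ℕ.+ sum ds ≡ k × π ≡ encode m n (cs , ds)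
-- Being larger than `k`, both lengths are successors; `Has1324-⊕⁺` and `decode-surjective₂` rely on
-- nonempty summands.
counted⇒encode {m = suc m} {suc n} k<m k<n π (π! , refl , av1324 ∷ av4321 ∷ [])
  with α , β , refl ← ⊕-decompose π π! (no-crossing-inversion π π! (avoids1324⁻ π av1324) k<m k<n) =
  let α! , β! = ⊕-isPermutation⁻ α β π!
      cs , p , sum-cs , α≡ = decode-surjective₂ m α α!
        (avoids1324⁻ (α ⊕ β) av1324 ∘ Has1324-⊕⁺ α β ∘ inj₁) (avoids4321⁻ (α ⊕ β) av4321 ∘ Has4321-⊕⁺ α β ∘ inj₁)
      ds , q , sum-ds , rcβ≡ = decode-surjective₂ n (rc β) (rc-isPermutation β β!)
        (avoids1324⁻ (α ⊕ β) av1324 ∘ Has1324-⊕⁺ α β ∘ inj₂ ∘ Has132-rc β)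
        (avoids4321⁻ (α ⊕ β) av4321 ∘ Has4321-⊕⁺ α β ∘ inj₂ ∘ Has4321-rc β)
  in cs , ds , p , q ,
     trans (cong₂ ℕ._+_ sum-cs (trans sum-ds (inversions-rc β))) (sym (inversions-⊕ α β)) ,
     cong₂ _⊕_ α≡ (trans (sym (rc-involutive β)) (cong rc rcβ≡))

encode-injective : ∀ {cs cs′ ds ds′} → AtMostTwoSizes cs → AtMostTwoSizes cs′ → AtMostTwoSizes ds → AtMostTwoSizes ds′ →
                   sum cs < m → sum cs′ < m → sum ds < n → sum ds′ < n →
                   encode m n (cs , ds) ≡ encode m n (cs′ , ds′) → (cs , ds) ≡ (cs′ , ds′)
encode-injective {m} {n} {cs} {cs′} (_ , _ , p) (_ , _ , p′) (_ , _ , q) (_ , _ , q′) c<m c′<m d<n d′<n eq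
  with α≡ , β≡ ← ⊕-injective (decode m cs) (decode m cs′) eq =
  cong₂ _,_ (decode-injective m p p′ (sum<⇒Fits p c<m) (sum<⇒Fits p′ c′<m) α≡)
            (decode-injective n q q′ (sum<⇒Fits q d<n) (sum<⇒Fits q′ d′<n)
              (trans (sym (rc-involutive _)) (trans (cong rc β≡) (rc-involutive _))))

-- Enumeration of partitions with at most two part sizes

-- Multiplication by a power of the variable. The type of entries is arbitrary so that the same
-- operation acts on families of lists, with default `[]`, and on coefficients, with default `0ℤ`;
-- `shift-map` passes from one to the other.
shift : A → ℕ → (ℕ → A) → ℕ → A
shift x zero    f n       = f n
shift x (suc k) f zero    = x
shift x (suc k) f (suc n) = shift x k f n

shift-cong-≤ : ∀ {x : A} k {f g : ℕ → A} n → (∀ i → i ≤ n → f i ≡ g i) → shift x k f n ≡ shift x k g n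
shift-cong-≤ zero    n       f≡g = f≡g n ℕ.≤-refl
shift-cong-≤ (suc k) zero    f≡g = refl
shift-cong-≤ (suc k) (suc n) f≡g = shift-cong-≤ k n (λ i i≤n → f≡g i (ℕ.m≤n⇒m≤1+n i≤n))

shift-map : ∀ (h : A → B) {x : A} k f n → h (shift x k f n) ≡ shift (h x) k (h ∘ f) n
shift-map h zero    f n       = refl
shift-map h (suc k) f zero    = refl
shift-map h (suc k) f (suc n) = shift-map h k f n

shift-+ : ∀ {x : A} k f n → shift x k f (k ℕ.+ n) ≡ f n
shift-+ zero    f n = refl
shift-+ (suc k) f n = shift-+ k f n

∈-shift⁻ : ∀ k (G : ℕ → List A) n {z} → z ∈ shift [] k G n → ∃[ i ] n ≡ k ℕ.+ i × z ∈ G i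
∈-shift⁻ zero    G n       z∈ = n , refl , z∈
∈-shift⁻ (suc k) G (suc n) z∈ with i , refl , z∈′ ← ∈-shift⁻ k G n z∈ = i , refl , z∈′

shift! : ∀ k (G : ℕ → List A) → (∀ n → Unique (G n)) → ∀ n → Unique (shift [] k G n)
shift! zero    G G! n       = G! n
shift! (suc k) G G! zero    = []
shift! (suc k) G G! (suc n) = shift! k G G! n

-- In runs f c G n, the fuel f bounds the number of copies of c in front of a member of G.
runs : ℕ → ℕ → (ℕ → List (List ℕ)) → ℕ → List (List ℕ)
runs zero    c G n = []
runs (suc f) c G n = List.map (c ∷_) (shift [] c (λ i → G i ++ runs f c G i) n)

run : ℕ → (ℕ → List (List ℕ)) → ℕ → List (List ℕ)
run c G n = runs n c G n

-- Each copy of the positive part `suc c` uses up at least one unit of `n`, so fuel beyond `n` is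
-- never reached.
runs-fuel : ∀ c G f g n → n ≤ f → n ≤ g → runs f (suc c) G n ≡ runs g (suc c) G n
runs-fuel c G zero    zero    n       _         _         = refl
runs-fuel c G zero    (suc g) zero    _         _         = refl
runs-fuel c G (suc f) zero    zero    _         _         = refl
runs-fuel c G (suc f) (suc g) zero    _         _         = refl
runs-fuel c G (suc f) (suc g) (suc n) (s≤s n≤f) (s≤s n≤g) = cong (List.map (suc c ∷_))
  (shift-cong-≤ c n λ i i≤n → cong (G i ++_) (runs-fuel c G f g i (ℕ.≤-trans i≤n n≤f) (ℕ.≤-trans i≤n n≤g)))

run-unfold : ∀ c G n → run (suc c) G n ≡ List.map (suc c ∷_) (shift [] (suc c) (λ i → G i ++ run (suc c) G i) n)
run-unfold c G zero    = refl
run-unfold c G (suc n) = cong (List.map (suc c ∷_))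
  (shift-cong-≤ c n λ i i≤n → cong (G i ++_) (runs-fuel c G n i i i≤n ℕ.≤-refl))

data Run (c : ℕ) (P : List ℕ → Set) : List ℕ → Set where
  start : ∀ {cs} → P cs → Run c P (c ∷ cs)
  more  : ∀ {cs} → Run c P cs → Run c P (c ∷ cs)

record Enumerates (G : ℕ → List (List ℕ)) (P : List ℕ → Set) : Set where
  field
    unique   : ∀ n → Unique (G n)
    sound    : ∀ n {cs} → cs ∈ G n → P cs × sum cs ≡ n
    complete : ∀ {cs} → P cs → cs ∈ G (sum cs)

open Enumerates

largest-Run : ∀ {c P cs} → Run c P cs → largest cs ≡ c
largest-Run (start _) = refl
largest-Run (more _)  = refl

enumerates-cong : ∀ {G P Q} → (∀ {cs} → P cs → Q cs) → (∀ {cs} → Q cs → P cs) → Enumerates G P → Enumerates G Q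
enumerates-cong P⊆Q Q⊆P enum = record
  { unique   = unique enum
  ; sound    = λ n cs∈ → map P⊆Q id (sound enum n cs∈)
  ; complete = λ q → complete enum (Q⊆P q)
  }

++-enumerates : ∀ {G H P Q} → (∀ {cs} → P cs → ¬ Q cs) → Enumerates G P → Enumerates H Q →
                Enumerates (λ n → G n ++ H n) (λ cs → P cs ⊎ Q cs)
++-enumerates {G} {H} {P} {Q} exclusive eG eH = record
  { unique   = λ n → Unique.++⁺ (unique eG n) (unique eH n) λ (∈G , ∈H) →
      exclusive (proj₁ (sound eG n ∈G)) (proj₁ (sound eH n ∈H))
  ; sound    = sound′
  ; complete = λ {cs} → [ ∈-++⁺ˡ ∘ complete eG , ∈-++⁺ʳ (G (sum cs)) ∘ complete eH ]′
  }
  where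
  sound′ : ∀ n {cs} → cs ∈ G n ++ H n → (P cs ⊎ Q cs) × sum cs ≡ n
  sound′ n cs∈ with ∈-++⁻ (G n) cs∈
  ... | inj₁ ∈G = map inj₁ id (sound eG n ∈G)
  ... | inj₂ ∈H = map inj₂ id (sound eH n ∈H)

-- The union is over infinitely many indices, but only those below `N n` contribute lists of sum
-- `n`. The bound is a parameter so that it can agree with the truncation of the sums `∑≥`.
concat-enumerates : ∀ (N : ℕ → ℕ) (G : ℕ → ℕ → List (List ℕ)) (P : ℕ → List ℕ → Set) →
                    (∀ {i j cs} → P i cs → P j cs → i ≡ j) → (∀ {j cs} → P j cs → j < N (sum cs)) →
                    (∀ j → Enumerates (G j) (P j)) →
                    Enumerates (λ n → concat (List.tabulate {n = N n} λ j → G (toℕ j) n)) (λ cs → ∃[ j ] P j cs)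
concat-enumerates N G P exclusive bound enum = record
  { unique   = λ n → concat-tabulate! (Gs n) (λ j → unique (enum (toℕ j)) n) λ {i} {j} ∈i ∈j →
      Fin.toℕ-injective (exclusive (proj₁ (sound (enum (toℕ i)) n ∈i)) (proj₁ (sound (enum (toℕ j)) n ∈j)))
  ; sound    = λ n cs∈ → let j , ∈j = ∈-concat-tabulate⁻ (Gs n) cs∈ in map (toℕ j ,_) id (sound (enum (toℕ j)) n ∈j)
  ; complete = λ {cs} (j , p) → let n = sum cs ; j< = bound p in ∈-concat-tabulate⁺ (Gs n) (fromℕ< j<)
      (subst (λ j → cs ∈ G j n) (sym (Fin.toℕ-fromℕ< j<)) (complete (enum j) p))
  }
  where
  Gs : ∀ n → Fin (N n) → List (List ℕ)
  Gs n j = G (toℕ j) n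

-- A list that ends its run of `c` continues with a member of `P`, whose largest part is below `c`,
-- whereas a longer run continues with `c` itself. So no list arises in two ways.
run-enumerates : ∀ {c G P} → 0 < c → (∀ {cs} → P cs → largest cs < c) → Enumerates G P → Enumerates (run c G) (Run c P)
run-enumerates {c@(suc c′)} {G} {P} _ <c enum = record
  { unique   = λ n → runs! n n
  ; sound    = λ n → runs-sound n n
  ; complete = λ r → runs-complete _ r ℕ.≤-refl
  }
  where
  runs-sound : ∀ f n {cs} → cs ∈ runs f c G n → Run c P cs × sum cs ≡ n
  runs-sound (suc f) n cs∈ with ds , ds∈ , refl ← ∈-map⁻ (c ∷_) cs∈ with i , refl , ds∈′ ← ∈-shift⁻ c _ n ds∈
    with ∈-++⁻ (G i) ds∈′
  ... | inj₁ ∈G with p , refl ← sound enum i ∈G = start p , refl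
  ... | inj₂ ∈runs with r , refl ← runs-sound f i ∈runs = more r , refl
  runs-complete : ∀ f {cs} → Run c P cs → sum cs ≤ f → cs ∈ runs f c G (sum cs)
  runs-complete (suc f) (start {cs} p) _ = ∈-map⁺ (c ∷_)
    (subst (cs ∈_) (sym (shift-+ c _ (sum cs))) (∈-++⁺ˡ (complete enum p)))
  runs-complete (suc f) (more {cs} r) (s≤s sum≤f) = ∈-map⁺ (c ∷_)
    (subst (cs ∈_) (sym (shift-+ c _ (sum cs))) (∈-++⁺ʳ (G (sum cs))
      (runs-complete f r (ℕ.≤-trans (ℕ.m≤n+m _ c′) sum≤f))))
  runs! : ∀ f n → Unique (runs f c G n)
  runs! zero    n = []
  runs! (suc f) n = Unique.map⁺ List.∷-injectiveʳ (shift! c _ (λ i → Unique.++⁺ (unique enum i) (runs! f i) disjoint) n)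
    where
    disjoint : ∀ {i} → Disjoint (G i) (runs f c G i)
    disjoint (∈G , ∈runs) = ℕ.<⇒≢ (<c (proj₁ (sound enum _ ∈G))) (largest-Run (proj₁ (runs-sound f _ ∈runs)))

emptyOnly : ℕ → List (List ℕ)
emptyOnly zero    = [] ∷ []
emptyOnly (suc _) = []

emptyOnly-enumerates : Enumerates emptyOnly (_≡ [])
emptyOnly-enumerates = record
  { unique   = λ { zero → [] ∷ [] ; (suc _) → [] }
  ; sound    = λ { zero (here refl) → refl , refl }
  ; complete = λ { refl → here refl }
  }

singles : ℕ → ℕ → List (List ℕ)
singles k = run k emptyOnly

doubles : ℕ → ℕ → ℕ → List (List ℕ)
doubles k i = run i (singles k)

OneSize : ℕ → List ℕ → Set
OneSize k = Run k (_≡ [])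

TwoSizes : ℕ → ℕ → List ℕ → Set
TwoSizes k i = Run i (OneSize k)

singles-enumerates : ∀ {k} → 0 < k → Enumerates (singles k) (OneSize k)
singles-enumerates 0<k = run-enumerates 0<k (λ { refl → 0<k }) emptyOnly-enumerates

doubles-enumerates : ∀ {k i} → 0 < k → k < i → Enumerates (doubles k i) (TwoSizes k i)
doubles-enumerates 0<k k<i = run-enumerates (ℕ.<-trans 0<k k<i)
  (λ r → subst (_< _) (sym (largest-Run r)) k<i) (singles-enumerates 0<k)

Run-map : ∀ {c P Q cs} → (∀ {cs} → P cs → Q cs) → Run c P cs → Run c Q cs
Run-map P⊆Q (start p) = start (P⊆Q p)
Run-map P⊆Q (more r)  = more (Run-map P⊆Q r)

Run⇒Partition : ∀ {c P j cs} → (∀ {cs} → P cs → Partition j cs × largest cs < c) → Run c P cs → Partition (suc j) cs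
Run⇒Partition P⇒ (start p) = let q , <c = P⇒ p in larger <c q
Run⇒Partition P⇒ (more r@(start _)) = again (Run⇒Partition P⇒ r)
Run⇒Partition P⇒ (more r@(more _))  = again (Run⇒Partition P⇒ r)

Partition⇒Run : ∀ {j cs} → Partition (suc j) cs → Run (largest cs) (λ ds → Partition j ds × largest ds < largest cs) cs
Partition⇒Run (again p)     = more (Partition⇒Run p)
Partition⇒Run (larger c> p) = start (p , c>)

Run-∃ : ∀ {c cs} {Q : ℕ → List ℕ → Set} → Run c (λ ds → ∃[ k ] Q k ds) cs → ∃[ k ] Run c (Q k) cs
Run-∃ (start (k , q)) = k , start q
Run-∃ (more r)        = let k , r′ = Run-∃ r in k , more r′

Partition-unique : ∀ {i j cs} → Partition i cs → Partition j cs → i ≡ j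
Partition-unique empty         empty         = refl
Partition-unique (again p)     (again q)     = Partition-unique p q
Partition-unique (larger _ p)  (larger _ q)  = cong suc (Partition-unique p q)
Partition-unique (again _)     (larger c> _) = contradiction c> (ℕ.<-irrefl refl)
Partition-unique (larger c> _) (again _)     = contradiction c> (ℕ.<-irrefl refl)

OneSize⇒Partition : ∀ {k cs} → 0 < k → OneSize k cs → Partition 1 cs
OneSize⇒Partition 0<k = Run⇒Partition λ { refl → empty , 0<k }

TwoSizes⇒Partition : ∀ {k i cs} → 0 < k → k < i → TwoSizes k i cs → Partition 2 cs
TwoSizes⇒Partition 0<k k<i = Run⇒Partition λ r → OneSize⇒Partition 0<k r , subst (_< _) (sym (largest-Run r)) k<i

Partition⇒OneSize : ∀ {cs} → Partition 1 cs → OneSize (largest cs) cs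
Partition⇒OneSize p = Run-map (λ { (empty , _) → refl }) (Partition⇒Run p)

Partition-largest>0 : ∀ {j cs} → Partition (suc j) cs → 0 < largest cs
Partition-largest>0 {cs = c ∷ cs} p = part-positive p

-- The smaller size is found only inside the run of the larger one; `Run-∃` moves it outside, and
-- `Q` carries its bounds along.
Partition⇒TwoSizes : ∀ {cs} → Partition 2 cs → ∃[ k ] 0 < k × k < largest cs × TwoSizes k (largest cs) cs
Partition⇒TwoSizes {cs} p =
  let k , r = Run-∃ {Q = Q} (Run-map split-off (Partition⇒Run p)) ; 0<k , k<i = bounds r in
  k , 0<k , k<i , Run-map proj₁ r
  where
  Q : ℕ → List ℕ → Set
  Q k ds = OneSize k ds × 0 < k × k < largest cs
  split-off : ∀ {ds} → Partition 1 ds × largest ds < largest cs → ∃[ k ] Q k ds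
  split-off {ds} (q , <c) = largest ds , Partition⇒OneSize q , Partition-largest>0 q , <c
  bounds : ∀ {c k ds} → Run c (Q k) ds → 0 < k × k < largest cs
  bounds (start (_ , b)) = b
  bounds (more r)        = bounds r

TwoSizes-unique : ∀ {k k′ i i′ cs} → k < i → k′ < i′ → TwoSizes k i cs → TwoSizes k′ i′ cs → k ≡ k′
TwoSizes-unique {i = i} k<i k′<i r r′ with refl ← trans (sym (largest-Run r)) (largest-Run r′) = go k<i k′<i r r′
  where
  go : ∀ {k k′ cs} → k < i → k′ < i → TwoSizes k i cs → TwoSizes k′ i cs → k ≡ k′
  go k<i k′<i (start r) (start r′) = trans (sym (largest-Run r)) (largest-Run r′)
  go k<i k′<i (more r)  (more r′)  = go k<i k′<i r r′
  go k<i k′<i (start r) (more r′)  = contradiction (trans (sym (largest-Run r)) (largest-Run r′)) (ℕ.<⇒≢ k<i)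
  go k<i k′<i (more r)  (start r′) = contradiction (trans (sym (largest-Run r′)) (largest-Run r)) (ℕ.<⇒≢ k′<i)

largest≤sum : ∀ cs → largest cs ≤ sum cs
largest≤sum []       = z≤n
largest≤sum (c ∷ cs) = ℕ.m≤m+n c (sum cs)

-- The ranges are those of `∑≥`: the summability witness `suc n` leaves `suc n ∸ 1` terms of a sum
-- from 1, and `suc n ∸ (2 ℕ.+ j)` terms of the inner sum that belongs to `suc j`. So lists and
-- terms correspond one by one.
allSingles allDoubles partitions : ℕ → List (List ℕ)
doublesWith : ℕ → ℕ → List (List ℕ)
allSingles n = concat (List.tabulate {n = n} λ j → singles (suc (toℕ j)) n)
doublesWith j n = concat (List.tabulate {n = n ∸ suc j} λ l → doubles (suc j) (2 ℕ.+ j ℕ.+ toℕ l) n)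
allDoubles n = concat (List.tabulate {n = n} λ j → doublesWith (toℕ j) n)
partitions n = (emptyOnly n ++ allSingles n) ++ allDoubles n

1+j<2+j+l : ∀ j l → suc j < 2 ℕ.+ j ℕ.+ l
1+j<2+j+l j l = s≤s (s≤s (ℕ.m≤m+n j l))

allSingles-enumerates : Enumerates allSingles (Partition 1)
allSingles-enumerates = enumerates-cong (λ (_ , r) → OneSize⇒Partition z<s r) backward
  (concat-enumerates id (singles ∘ suc) (OneSize ∘ suc)
    (λ r r′ → ℕ.suc-injective (trans (sym (largest-Run r)) (largest-Run r′)))
    (λ {_} {cs} r → subst (_≤ sum cs) (largest-Run r) (largest≤sum cs))
    (λ _ → singles-enumerates z<s))
  where
  backward : ∀ {cs} → Partition 1 cs → ∃[ j ] OneSize (suc j) cs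
  backward {cs} p with largest cs | Partition-largest>0 p | Partition⇒OneSize p
  ... | suc k | _ | r = k , r

doublesWith-enumerates : ∀ j → Enumerates (doublesWith j) (λ cs → ∃[ l ] TwoSizes (suc j) (2 ℕ.+ j ℕ.+ l) cs)
doublesWith-enumerates j = concat-enumerates (_∸ suc j) (λ l → doubles (suc j) (2 ℕ.+ j ℕ.+ l))
  (λ l → TwoSizes (suc j) (2 ℕ.+ j ℕ.+ l))
  (λ r r′ → ℕ.+-cancelˡ-≡ (2 ℕ.+ j) _ _ (trans (sym (largest-Run r)) (largest-Run r′)))
  (λ {l} {cs} r → ℕ.m+n≤o⇒m≤o∸n (suc l)
    (subst (_≤ sum cs) (trans (largest-Run r) (cong suc (ℕ.+-comm (suc j) l))) (largest≤sum cs)))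
  (λ l → doubles-enumerates z<s (1+j<2+j+l j l))

allDoubles-enumerates : Enumerates allDoubles (Partition 2)
allDoubles-enumerates = enumerates-cong (λ (j , l , r) → TwoSizes⇒Partition z<s (1+j<2+j+l j l) r) backward
  (concat-enumerates id doublesWith (λ j cs → ∃[ l ] TwoSizes (suc j) (2 ℕ.+ j ℕ.+ l) cs)
    (λ {j} {j′} (l , r) (l′ , r′) → ℕ.suc-injective (TwoSizes-unique (1+j<2+j+l j l) (1+j<2+j+l j′ l′) r r′))
    (λ {j} {cs} (l , r) → ℕ.≤-trans (ℕ.<⇒≤ (1+j<2+j+l j l)) (subst (_≤ sum cs) (largest-Run r) (largest≤sum cs)))
    doublesWith-enumerates)
  where
  backward : ∀ {cs} → Partition 2 cs → ∃[ j ] ∃[ l ] TwoSizes (suc j) (2 ℕ.+ j ℕ.+ l) cs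
  backward {cs} p with Partition⇒TwoSizes p
  ... | suc k , _ , k<i , r =
    k , largest cs ∸ (2 ℕ.+ k) , subst (λ i → TwoSizes (suc k) i cs) (sym (ℕ.m+[n∸m]≡n k<i)) r

partitions-enumerates : Enumerates partitions AtMostTwoSizes
partitions-enumerates = enumerates-cong forward backward
  (++-enumerates (λ { (inj₁ p) q → case Partition-unique p q of λ () ; (inj₂ p) q → case Partition-unique p q of λ () })
    (++-enumerates (λ p q → case Partition-unique p q of λ ())
      (enumerates-cong (λ { refl → empty }) (λ { empty → refl }) emptyOnly-enumerates)
      allSingles-enumerates)
    allDoubles-enumerates)
  where
  forward : ∀ {cs} → (Partition 0 cs ⊎ Partition 1 cs) ⊎ Partition 2 cs → AtMostTwoSizes cs
  forward (inj₁ (inj₁ p)) = 0 , z≤n , p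
  forward (inj₁ (inj₂ p)) = 1 , s≤s z≤n , p
  forward (inj₂ p)        = 2 , ℕ.≤-refl , p
  backward : ∀ {cs} → AtMostTwoSizes cs → (Partition 0 cs ⊎ Partition 1 cs) ⊎ Partition 2 cs
  backward (0 , _ , p) = inj₁ (inj₁ p)
  backward (1 , _ , p) = inj₁ (inj₂ p)
  backward (2 , _ , p) = inj₂ p
  backward (suc (suc (suc _)) , s≤s (s≤s ()) , _)

-- Power series

∑-distrib-- : ∀ {n} (f g : Fin n → ℤ) → ∑[ i < n ] (f i ℤ.- g i) ≡ ∑[ i < n ] f i ℤ.- ∑[ i < n ] g i
∑-distrib-- {zero}  f g = refl
∑-distrib-- {suc n} f g = trans (cong (λ z → f zero ℤ.- g zero ℤ.+ z) (∑-distrib-- (f ∘ suc) (g ∘ suc)))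
  (solve 4 (λ a b c d → (a :- b) :+ (c :- d) := (a :+ c) :- (b :+ d)) refl (f zero) (g zero) _ _)
  where open +-*-Solver

shiftₛ : ℕ → PowerSeries → PowerSeries
shiftₛ = shift 0ℤ

shiftₛ-cong : ∀ k {f g} → f ≗ g → shiftₛ k f ≗ shiftₛ k g
shiftₛ-cong k f≗g n = shift-cong-≤ k n (λ i _ → f≗g i)

shiftₛ-+ : ∀ k f g → shiftₛ k (f + g) ≗ shiftₛ k f + shiftₛ k g
shiftₛ-+ zero    f g n       = refl
shiftₛ-+ (suc k) f g zero    = refl
shiftₛ-+ (suc k) f g (suc n) = shiftₛ-+ k f g n

shiftₛ-- : ∀ k f g → shiftₛ k (f - g) ≗ shiftₛ k f - shiftₛ k g
shiftₛ-- zero    f g n       = refl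
shiftₛ-- (suc k) f g zero    = refl
shiftₛ-- (suc k) f g (suc n) = shiftₛ-- k f g n

shiftₛ-shiftₛ : ∀ i k f → shiftₛ i (shiftₛ k f) ≗ shiftₛ (i ℕ.+ k) f
shiftₛ-shiftₛ zero    k f n       = refl
shiftₛ-shiftₛ (suc i) k f zero    = refl
shiftₛ-shiftₛ (suc i) k f (suc n) = shiftₛ-shiftₛ i k f n

shiftₛ-comm : ∀ i k f → shiftₛ i (shiftₛ k f) ≗ shiftₛ k (shiftₛ i f)
shiftₛ-comm i k f n = trans (shiftₛ-shiftₛ i k f n)
  (trans (cong (λ j → shiftₛ j f n) (ℕ.+-comm i k)) (sym (shiftₛ-shiftₛ k i f n)))

shiftₛ-x^ : ∀ k j → shiftₛ k (x^ j) ≗ x^ (k ℕ.+ j)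
shiftₛ-x^ zero    j n       = refl
shiftₛ-x^ (suc k) j zero    = refl
shiftₛ-x^ (suc k) j (suc n) = shiftₛ-x^ k j n

*-congʳ : ∀ {f g} h → f ≗ g → f * h ≗ g * h
*-congʳ h f≗g n = sum-cong-≗ {suc n} λ i → cong (ℤ._* h (n ∸ toℕ i)) (f≗g (toℕ i))

*-congˡ : ∀ f {g h} → g ≗ h → f * g ≗ f * h
*-congˡ f g≗h n = sum-cong-≗ {suc n} λ i → cong (f (toℕ i) ℤ.*_) (g≗h (n ∸ toℕ i))

*-distribʳ-- : ∀ f g h → (f - g) * h ≗ f * h - g * h
*-distribʳ-- f g h n = trans
  (sum-cong-≗ {suc n} λ i → solve 3 (λ a b c → (a :- b) :* c := a :* c :- b :* c) refl
    (f (toℕ i)) (g (toℕ i)) (h (n ∸ toℕ i)))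
  (∑-distrib-- {suc n} (λ i → f (toℕ i) ℤ.* h (n ∸ toℕ i)) (λ i → g (toℕ i) ℤ.* h (n ∸ toℕ i)))
  where open +-*-Solver

shiftₛ-* : ∀ k f g → shiftₛ k f * g ≗ shiftₛ k (f * g)
shiftₛ-* zero    f g n       = refl
shiftₛ-* (suc k) f g zero    = cong (ℤ._+ 0ℤ) (ℤ.*-zeroˡ (g 0))
shiftₛ-* (suc k) f g (suc n) = trans (cong (ℤ._+ (shiftₛ k f * g) n) (ℤ.*-zeroˡ (g (suc n))))
  (trans (ℤ.+-identityˡ _) (shiftₛ-* k f g n))

1ₛ-*-identityˡ : ∀ f → 1ₛ * f ≗ f
1ₛ-*-identityˡ f n = trans (cong₂ ℤ._+_ (ℤ.*-identityˡ (f n)) (sum-zero {n} _ λ i → ℤ.*-zeroˡ (f (n ∸ suc (toℕ i)))))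
  (ℤ.+-identityʳ (f n))

x^-* : ∀ k f → x^ k * f ≗ shiftₛ k f
x^-* k f n = trans (*-congʳ f (λ i → sym (trans (shiftₛ-x^ k 0 i) (cong (λ j → (x^ j) i) (ℕ.+-identityʳ k)))) n)
  (trans (shiftₛ-* k 1ₛ f n) (shiftₛ-cong k (1ₛ-*-identityˡ f) n))

[1-x^]-* : ∀ k f → (1ₛ - x^ k) * f ≗ f - shiftₛ k f
[1-x^]-* k f n = trans (*-distribʳ-- 1ₛ (x^ k) f n) (cong₂ ℤ._-_ (1ₛ-*-identityˡ f n) (x^-* k f n))

-- Multiplication by `1ₛ - x^ k` subtracts a shifted copy, and shifts pass through products. This
-- instance of associativity is all that the product of two denominators requires.
[1-x^]-*-assoc : ∀ k f g → (1ₛ - x^ k) * f * g ≗ (1ₛ - x^ k) * (f * g)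
[1-x^]-*-assoc k f g n = begin
  ((1ₛ - x^ k) * f * g) n        ≡⟨ *-congʳ g ([1-x^]-* k f) n ⟩
  ((f - shiftₛ k f) * g) n       ≡⟨ *-distribʳ-- f (shiftₛ k f) g n ⟩
  (f * g - shiftₛ k f * g) n     ≡⟨ cong (λ z → (f * g) n ℤ.- z) (shiftₛ-* k f g n) ⟩
  (f * g - shiftₛ k (f * g)) n   ≡⟨ [1-x^]-* k (f * g) n ⟨
  ((1ₛ - x^ k) * (f * g)) n      ∎
  where open ≡-Reasoning

-- Since `g` has constant coefficient 1, coefficient `n` of `g * h` is `h n` plus terms in earlier
-- coefficients of `h`. Strong induction thus recovers the recursion behind `f / g`.
/-unique : ∀ f g h → g 0 ≡ 1ℤ → g * h ≗ f → h ≗ f / g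
/-unique f g h g0≡1 gh≗f n = <-rec (λ n → h n ≡ (f / g) n) step n
  where
  open ≡-Reasoning
  step : ∀ n → (∀ {m} → m < n → h m ≡ (f / g) m) → h n ≡ (f / g) n
  step n ih = begin
    h n                                 ≡⟨ ℤ.*-identityˡ (h n) ⟨
    1ℤ ℤ.* h n                          ≡⟨ cong (ℤ._* h n) g0≡1 ⟨
    g 0 ℤ.* h n                         ≡⟨ solve 2 (λ a b → a := (a :+ b) :- b) refl _ (rest h) ⟩
    (g * h) n ℤ.- rest h                ≡⟨ cong₂ ℤ._-_ (gh≗f n) rest≡ ⟩
    (f / g) n                           ∎
    where
    open +-*-Solver
    rest : PowerSeries → ℤ
    rest h = ∑[ i < n ] (g (suc (toℕ i)) ℤ.* h (n ∸ suc (toℕ i)))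
    n∸ : (i : Fin n) → n ∸ suc (toℕ i) < n
    n∸ i = ℕ.∸-monoʳ-< z<s (Fin.toℕ<n i)
    rest≡ : rest h ≡ ∑[ i < n ] (g (suc (toℕ i)) ℤ.* lookup (quotientPrefix f g n) i)
    rest≡ = sum-cong-≗ {n} λ i → cong (g (suc (toℕ i)) ℤ.*_) (trans (ih (n∸ i)) (sym (lookup-quotientPrefix f g n i)))

-- Generating functions of the enumerations

counting : (ℕ → List A) → PowerSeries
counting G n = + length (G n)

counting-emptyOnly : counting emptyOnly ≗ 1ₛ
counting-emptyOnly zero    = refl
counting-emptyOnly (suc n) = refl

-- Removing the first copy of `c` leaves a member of `G` or a shorter run.
counting-run : ∀ {c} G → 0 < c → counting (run c G) ≗ shiftₛ c (counting G + counting (run c G))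
counting-run {c@(suc c′)} G _ n = begin
  + length (run c G n)                             ≡⟨ cong (ℤ.+_ ∘ length) (run-unfold c′ G n) ⟩
  + length (List.map (c ∷_) (shift [] c H n))      ≡⟨ cong ℤ.+_ (List.length-map (c ∷_) (shift [] c H n)) ⟩
  + length (shift [] c H n)                        ≡⟨ shift-map (ℤ.+_ ∘ length) c H n ⟩
  shiftₛ c (counting H) n                          ≡⟨ shiftₛ-cong c (λ i → cong ℤ.+_ (List.length-++ (G i))) n ⟩
  shiftₛ c (counting G + counting (run c G)) n     ∎
  where
  open ≡-Reasoning
  H : ℕ → List (List ℕ)
  H i = G i ++ run c G i

[1-x^]-*-counting-run : ∀ {c} G → 0 < c → (1ₛ - x^ c) * counting (run c G) ≗ shiftₛ c (counting G)
[1-x^]-*-counting-run {c} G 0<c n = begin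
  ((1ₛ - x^ c) * R) n                                ≡⟨ [1-x^]-* c R n ⟩
  R n ℤ.- shiftₛ c R n                               ≡⟨ cong (ℤ._- shiftₛ c R n)
                                                          (trans (counting-run G 0<c n) (shiftₛ-+ c (counting G) R n)) ⟩
  (shiftₛ c (counting G) n ℤ.+ shiftₛ c R n) ℤ.- shiftₛ c R n
                                                     ≡⟨ solve 2 (λ a b → (a :+ b) :- b := a) refl _ _ ⟩
  shiftₛ c (counting G) n                            ∎
  where
  open ≡-Reasoning
  open +-*-Solver
  R = counting (run c G)

[1-x^]-*-singles : ∀ {k} → 0 < k → (1ₛ - x^ k) * counting (singles k) ≗ x^ k
[1-x^]-*-singles {k} 0<k n = trans ([1-x^]-*-counting-run emptyOnly 0<k n)
  (trans (shiftₛ-cong k counting-emptyOnly n) (trans (shiftₛ-x^ k 0 n) (cong (λ j → (x^ j) n) (ℕ.+-identityʳ k))))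

counting-singles : ∀ {k} → 0 < k → counting (singles k) ≗ singleTerm k
-- Matching `k` as a successor lets the constant coefficient of the denominator evaluate to 1.
counting-singles {k@(suc _)} 0<k = /-unique (x^ k) (1ₛ - x^ k) _ refl ([1-x^]-*-singles 0<k)

-- The outer run absorbs the factor `1ₛ - x^ i` and leaves the singles shifted by `i`; as shifts
-- commute, the factor `1ₛ - x^ k` then acts on the singles alone.
counting-doubles : ∀ {k i} → 0 < k → 0 < i → counting (doubles k i) ≗ doubleTerm k i
counting-doubles {k@(suc _)} {i@(suc _)} 0<k 0<i =
  /-unique (x^ (k ℕ.+ i)) ((1ₛ - x^ k) * (1ₛ - x^ i)) D refl λ n → begin
  ((1ₛ - x^ k) * (1ₛ - x^ i) * D) n       ≡⟨ [1-x^]-*-assoc k (1ₛ - x^ i) D n ⟩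
  ((1ₛ - x^ k) * ((1ₛ - x^ i) * D)) n     ≡⟨ *-congˡ (1ₛ - x^ k) ([1-x^]-*-counting-run (singles k) 0<i) n ⟩
  ((1ₛ - x^ k) * shiftₛ i S) n            ≡⟨ [1-x^]-* k (shiftₛ i S) n ⟩
  (shiftₛ i S - shiftₛ k (shiftₛ i S)) n  ≡⟨ cong (λ z → shiftₛ i S n ℤ.- z) (shiftₛ-comm k i S n) ⟩
  (shiftₛ i S - shiftₛ i (shiftₛ k S)) n  ≡⟨ shiftₛ-- i S (shiftₛ k S) n ⟨
  shiftₛ i (S - shiftₛ k S) n             ≡⟨ shiftₛ-cong i (λ j → trans (sym ([1-x^]-* k S j)) ([1-x^]-*-singles 0<k j)) n ⟩
  shiftₛ i (x^ k) n                       ≡⟨ shiftₛ-x^ i k n ⟩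
  (x^ (i ℕ.+ k)) n                        ≡⟨ cong (λ j → (x^ j) n) (ℕ.+-comm i k) ⟩
  (x^ (k ℕ.+ i)) n                        ∎
  where
  open ≡-Reasoning
  S = counting (singles k)
  D = counting (doubles k i)

length-concat-tabulate : ∀ {n} (f : Fin n → List A) → + length (concat (List.tabulate f)) ≡ ∑[ i < n ] (+ length (f i))
length-concat-tabulate {n = zero}  f = refl
length-concat-tabulate {n = suc n} f =
  trans (cong ℤ.+_ (List.length-++ (f zero))) (cong (λ z → + length (f zero) ℤ.+ z) (length-concat-tabulate (f ∘ suc)))

partitionSeries : PowerSeries
partitionSeries = 1ₛ + ∑≥ 1 singleTerm singleTerm-summable + ∑≥ 1 innerSum innerSum-summable

counting-partitions : counting partitions ≗ partitionSeries
counting-partitions n = trans (cong ℤ.+_ (trans (List.length-++ (emptyOnly n ++ allSingles n))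
    (cong (ℕ._+ length (allDoubles n)) (List.length-++ (emptyOnly n)))))
  (cong₂ ℤ._+_ (cong₂ ℤ._+_ (counting-emptyOnly n) singles≡) doubles≡)
  where
  singles≡ : + length (allSingles n) ≡ ∑≥ 1 singleTerm singleTerm-summable n
  singles≡ = trans (length-concat-tabulate {n = n} (λ j → singles (suc (toℕ j)) n))
    (sum-cong-≗ {n} λ j → counting-singles {suc (toℕ j)} z<s n)
  doublesWith≡ : ∀ j → + length (doublesWith j n) ≡ innerSum (suc j) n
  doublesWith≡ j = trans (length-concat-tabulate {n = n ∸ suc j} (λ l → doubles (suc j) (2 ℕ.+ j ℕ.+ toℕ l) n))
    (sum-cong-≗ {n ∸ suc j} λ l → counting-doubles {suc j} {2 ℕ.+ j ℕ.+ toℕ l} z<s z<s n)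
  doubles≡ : + length (allDoubles n) ≡ ∑≥ 1 innerSum innerSum-summable n
  doubles≡ = trans (length-concat-tabulate {n = n} (λ j → doublesWith (toℕ j) n))
    (sum-cong-≗ {n} λ j → doublesWith≡ (toℕ j))

-- Pairs of partitions and the limit sequence

pairsAt : ∀ k → Fin (suc k) → List (List ℕ × List ℕ)
pairsAt k i = cartesianProduct (partitions (toℕ i)) (partitions (k ∸ toℕ i))

pairs : ℕ → List (List ℕ × List ℕ)
pairs k = concat (List.tabulate (pairsAt k))

∈-pairs⁻ : ∀ k {cs ds} → (cs , ds) ∈ pairs k → AtMostTwoSizes cs × AtMostTwoSizes ds × sum cs ℕ.+ sum ds ≡ k
∈-pairs⁻ k ∈pairs
  with i , ∈i ← ∈-concat-tabulate⁻ (pairsAt k) ∈pairs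
  with ∈l , ∈r ← ∈-cartesianProduct⁻ (partitions (toℕ i)) (partitions (k ∸ toℕ i)) ∈i
  with p , eq ← sound partitions-enumerates (toℕ i) ∈l | q , eq′ ← sound partitions-enumerates (k ∸ toℕ i) ∈r =
  p , q , trans (cong₂ ℕ._+_ eq eq′) (ℕ.m+[n∸m]≡n (ℕ.≤-pred (Fin.toℕ<n i)))

∈-pairs⁺ : ∀ {cs ds} → AtMostTwoSizes cs → AtMostTwoSizes ds → (cs , ds) ∈ pairs (sum cs ℕ.+ sum ds)
∈-pairs⁺ {cs} {ds} p q = ∈-concat-tabulate⁺ (pairsAt total) i
  (∈-cartesianProduct⁺ (subst (λ j → cs ∈ partitions j) (sym i≡) (complete partitions-enumerates p))
    (subst (λ j → ds ∈ partitions j) (sym (trans (cong (total ∸_) i≡) (ℕ.m+n∸m≡n (sum cs) (sum ds))))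
      (complete partitions-enumerates q)))
  where
  total = sum cs ℕ.+ sum ds
  i< : sum cs < suc total
  i< = s≤s (ℕ.m≤m+n (sum cs) (sum ds))
  i = fromℕ< i<
  i≡ : toℕ i ≡ sum cs
  i≡ = Fin.toℕ-fromℕ< i<

pairs! : ∀ k → Unique (pairs k)
pairs! k = concat-tabulate! (pairsAt k)
  (λ i → Unique.cartesianProduct⁺ (unique partitions-enumerates (toℕ i)) (unique partitions-enumerates (k ∸ toℕ i)))
  λ {i} {j} ∈i ∈j → Fin.toℕ-injective (trans (sym (sum-fst i ∈i)) (sum-fst j ∈j))
  where
  sum-fst : ∀ (i : Fin (suc k)) {z} → z ∈ pairsAt k i → sum (proj₁ z) ≡ toℕ i
  sum-fst i ∈i = proj₂ (sound partitions-enumerates (toℕ i)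
    (proj₁ (∈-cartesianProduct⁻ (partitions (toℕ i)) (partitions (k ∸ toℕ i)) ∈i)))

length-cartesianProduct : (xs : List A) (ys : List B) → length (cartesianProduct xs ys) ≡ length xs ℕ.* length ys
length-cartesianProduct []       ys = refl
length-cartesianProduct (x ∷ xs) ys = trans (List.length-++ (List.map (x ,_) ys))
  (cong₂ ℕ._+_ (List.length-map (x ,_) ys) (length-cartesianProduct xs ys))

counting-pairs : counting pairs ≗ counting partitions * counting partitions
counting-pairs k = trans (length-concat-tabulate (pairsAt k))
  (sum-cong-≗ {suc k} λ i → trans (cong ℤ.+_ (length-cartesianProduct (partitions (toℕ i)) (partitions (k ∸ toℕ i))))
    (ℤ.pos-* (length (partitions (toℕ i))) (length (partitions (k ∸ toℕ i)))))

-- `encode m n` maps `pairs k` bijectively onto the counted words. Neither list has repetitions, so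
-- inclusions in both directions suffice.
length-pairs : k < m → k < n → av patterns (m ℕ.+ n) k ≡ length (pairs k)
length-pairs {k} {m} {n} k<m k<n = trans
  (length-cong-⊆⊇ (Unique.filter⁺ counted (vecs! (m ℕ.+ n) (m ℕ.+ n))) image! filter⊆image image⊆filter)
  (List.length-map (encode m n) (pairs k))
  where
  counted = counted? patterns (m ℕ.+ n) k
  image : List (Word (m ℕ.+ n))
  image = List.map (encode m n) (pairs k)
  image! : Unique image
  image! = map-on-! (pairs! k) λ ∈₁ ∈₂ eq →
    let p , q , sum≡ = ∈-pairs⁻ k ∈₁ ; p′ , q′ , sum≡′ = ∈-pairs⁻ k ∈₂ in
    encode-injective p p′ q q′
      (fst< k<m sum≡) (fst< k<m sum≡′) (snd< k<n sum≡) (snd< k<n sum≡′) eq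
    where
    fst< : ∀ {a b c d} → c < d → a ℕ.+ b ≡ c → a < d
    fst< {a} {b} c<d refl = ℕ.≤-<-trans (ℕ.m≤m+n a b) c<d
    snd< : ∀ {a b c d} → c < d → a ℕ.+ b ≡ c → b < d
    snd< {a} {b} c<d refl = ℕ.≤-<-trans (ℕ.m≤n+m b a) c<d
  filter⊆image : ∀ {π} → π ∈ filter counted (vecs (m ℕ.+ n) (m ℕ.+ n)) → π ∈ image
  filter⊆image {π} π∈ =
    let cs , ds , p , q , sum≡k , π≡ = counted⇒encode k<m k<n π
          (proj₂ (∈-filter⁻ counted {xs = vecs (m ℕ.+ n) (m ℕ.+ n)} π∈)) in
    subst (_∈ image) (sym π≡) (∈-map⁺ (encode m n) (subst (λ k → (cs , ds) ∈ pairs k) sum≡k (∈-pairs⁺ p q)))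
  image⊆filter : ∀ {π} → π ∈ image → π ∈ filter counted (vecs (m ℕ.+ n) (m ℕ.+ n))
  image⊆filter {π} π∈ =
    let _ , ∈pairs , π≡ = ∈-map⁻ (encode m n) π∈ ; p , q , sum≡k = ∈-pairs⁻ k ∈pairs in
    ∈-filter⁺ counted (∈-vecs π) (subst (Counted patterns (m ℕ.+ n) k) (sym π≡) (encode-counted k<m k<n p q sum≡k))

av-stabilises : IsLimitSequence patterns (length ∘ pairs)
-- From this length on, a cut behind `suc k` letters leaves more than `k` letters on either side.
av-stabilises k = suc k ℕ.+ suc k , λ n n≥ →
  let k<n   = ℕ.m+n≤o⇒m≤o∸n (suc k) n≥
      split = ℕ.m+[n∸m]≡n (ℕ.≤-trans (ℕ.m≤m+n (suc k) (suc k)) n≥)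
  in trans (cong (λ N → av patterns N k) (sym split)) (length-pairs {k} {suc k} {n ∸ suc k} ℕ.≤-refl k<n)

generatingFunction-pairs : generatingFunction (length ∘ pairs) ≗ partitionSeries ²
generatingFunction-pairs k = begin
  counting pairs k                                 ≡⟨ counting-pairs k ⟩
  (counting partitions * counting partitions) k    ≡⟨ *-congʳ (counting partitions) counting-partitions k ⟩
  (partitionSeries * counting partitions) k        ≡⟨ *-congˡ partitionSeries counting-partitions k ⟩
  (partitionSeries * partitionSeries) k            ∎
  where open ≡-Reasoning

proposition5p10 : ∃[ c ] IsLimitSequence (p1324 ∷ p4321 ∷ []) c
    × generatingFunction c
    ≗ (1ₛ + ∑≥ 1 singleTerm singleTerm-summable + ∑≥ 1 innerSum innerSum-summable) ²
proposition5p10 = length ∘ pairs , av-stabilises , generatingFunction-pairs
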